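{- Let $\Phi=(D,\varphi)$ be a $\mathbb{T}$-gain digraph whose underlying digraph $D$ is strongly connected. Then $0$ is an eigenvalue of $Q(\Phi)$ if and only if $\Phi$ is cycle antibalanced. Moreover, when these conditions hold, $Q(\Phi)$ is cospectral with $L(D)$.
   Context: A digraph $D=(V,\mathcal{A})$ has a finite vertex set $V=\{v_1,\dots,v_n\}$ and a set $\mathcal{A}$ of ordered pairs of distinct vertices, called arcs (no loops; at most one arc from $v_i$ to $v_j$ for each ordered pair; opposite arcs may both be present). The out-degree $\deg^+(v)$ is the number of arcs leaving $v$. A directed cycle is a closed directed walk whose vertices are distinct except that the first and last coincide (so its length is at least $2$; length $2$ is allowed). $D$ is strongly connected if every ordered pair of vertices is joined by a directed path. Let $\mathbb{T}=\{z\in\mathbb{C}:|z|=1\}$. A $\mathbb{T}$-gain digraph is a pair $\Phi=(D,\varphi)$ with $\varphi:\mathcal{A}\to\mathbb{T}$ an arbitrary function (no relation between gains of opposite arcs). Its gain adjacency matrix $A(\Phi)$ has entries $A(\Phi)_{ij}=\varphi(v_i,v_j)$ if $(v_i,v_j)\in\mathcal{A}$ and $0$ otherwise; $A(D)$ is the $0/1$ adjacency matrix of $D$ (all gains $1$). With $D^+=\operatorname{diag}(\deg^+(v_1),\dots,\deg^+(v_n))$, the signless Laplacian is $Q(\Phi)=D^++A(\Phi)$, and the Laplacian of $D$ is $L(D)=D^+-A(D)$. The gain $\varphi(C)$ of a directed cycle is the product of the gains of its arcs; $\Phi$ is cycle antibalanced if $\varphi(C)=(-1)^{\ell(C)}$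 for every directed cycle $C$ of $D$, where $\ell(C)$ is the length of $C$. Two matrices are cospectral if they have the same characteristic polynomial. -}

module Defs where

open import Algebra.Bundles using (RawRing)
import Algebra.Definitions.RawSemiring as RawSemiringDefs
open import Data.Bool.Base using (Bool; true; false; T; if_then_else_)
open import Data.Fin.Base using (Fin; zero; suc; toℕ; punchIn)
open import Data.Fin.Properties using () renaming (_≟_ to _≟ᶠ_)
open import Data.Fin.Subset using (Subset) renaming (∣_∣ to card)
open import Data.List.Base using (List; []; _∷_; map; length)
open import Data.List.Relation.Unary.Unique.Propositional using (Unique)
open import Data.Nat.Base as ℕ using (ℕ; zero; suc)
import Data.Nat.Properties as ℕ
open import Data.Product.Base using (Σ-syntax; ∃-syntax; _×_; _,_)
open import Data.Rational.Base as ℚ using (ℚ; 0ℚ; 1ℚ; ½; ∣_∣; 1/_)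
import Data.Rational.Properties as ℚ
open import Data.Rational.Solver using (module +-*-Solver)
open import Data.Unit.Base using (tt)
import Data.Vec.Base as Vec
open import Level using (0ℓ; _⊔_)
open import Relation.Binary.Construct.Closure.ReflexiveTransitive using (Star; ε; _◅_)
open import Relation.Binary.PropositionalEquality
  using (_≡_; refl; sym; trans; cong; subst)
open import Relation.Nullary.Decidable using (does)
open import Relation.Nullary.Negation using (¬_)

------------------------------------------------------------------------
-- Real numbers: Cauchy sequences of rationals, with pointwise operations,
-- two sequences being equal when their difference tends to zero.

IsCauchy : (ℕ → ℚ) → Set
IsCauchy x = ∀ δ → 0ℚ ℚ.< δ →
  ∃[ N ] (∀ m n → N ℕ.≤ m → N ℕ.≤ n → ∣ x m ℚ.- x n ∣ ℚ.< δ)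

record ℝ : Set where
  constructor mkℝ
  field
    seq    : ℕ → ℚ
    cauchy : IsCauchy seq

open ℝ public

infix 4 _≈ℝ_

_≈ℝ_ : ℝ → ℝ → Set
x ≈ℝ y = ∀ δ → 0ℚ ℚ.< δ →
  ∃[ N ] (∀ n → N ℕ.≤ n → ∣ seq x n ℚ.- seq y n ∣ ℚ.< δ)

-- Abstract so that Cauchy moduli are never unfolded during conversion checking.
private abstract

  half : ∀ δ → 0ℚ ℚ.< δ → 0ℚ ℚ.< ½ ℚ.* δ
  half δ 0<δ =
    subst (ℚ._< ½ ℚ.* δ) (ℚ.*-zeroʳ ½) (ℚ.*-monoʳ-<-pos ½ 0<δ)

  halves : ∀ δ → ½ ℚ.* δ ℚ.+ ½ ℚ.* δ ≡ δ
  halves δ = trans (sym (ℚ.*-distribʳ-+ δ ½ ½)) (ℚ.*-identityˡ δ)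

  const-cauchy : ∀ q → IsCauchy (λ _ → q)
  const-cauchy q δ 0<δ = 0 , λ _ _ _ _ →
    subst (ℚ._< δ) (sym (cong ∣_∣ (ℚ.+-inverseʳ q))) 0<δ

  +-cauchy : ∀ x y → IsCauchy x → IsCauchy y → IsCauchy (λ n → x n ℚ.+ y n)
  +-cauchy x y cx cy δ 0<δ with cx _ (half δ 0<δ) | cy _ (half δ 0<δ)
  ... | N , p | M , q = N ℕ.⊔ M , λ m n N≤m N≤n → begin-strict
      ∣ (x m ℚ.+ y m) ℚ.- (x n ℚ.+ y n) ∣
        ≡⟨ cong ∣_∣ (regroup (x m) (y m) (x n) (y n)) ⟩
      ∣ (x m ℚ.- x n) ℚ.+ (y m ℚ.- y n) ∣
        ≤⟨ ℚ.∣p+q∣≤∣p∣+∣q∣ (x m ℚ.- x n) (y m ℚ.- y n) ⟩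
      ∣ x m ℚ.- x n ∣ ℚ.+ ∣ y m ℚ.- y n ∣
        <⟨ ℚ.+-mono-< (p m n (ℕ.m⊔n≤o⇒m≤o N M N≤m) (ℕ.m⊔n≤o⇒m≤o N M N≤n))
                      (q m n (ℕ.m⊔n≤o⇒n≤o N M N≤m) (ℕ.m⊔n≤o⇒n≤o N M N≤n)) ⟩
      ½ ℚ.* δ ℚ.+ ½ ℚ.* δ
        ≡⟨ halves δ ⟩
      δ ∎
    where
    open ℚ.≤-Reasoning
    regroup : ∀ a b c d →
      (a ℚ.+ b) ℚ.- (c ℚ.+ d) ≡ (a ℚ.- c) ℚ.+ (b ℚ.- d)
    regroup = solve 4 (λ a b c d →
      (a :+ b) :- (c :+ d) := (a :- c) :+ (b :- d)) refl
      where open +-*-Solver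

  neg-cauchy : ∀ x → IsCauchy x → IsCauchy (λ n → ℚ.- x n)
  neg-cauchy x cx δ 0<δ with cx δ 0<δ
  ... | N , p = N , λ m n N≤m N≤n →
    subst (ℚ._< δ)
      (trans (sym (ℚ.∣-p∣≡∣p∣ (x m ℚ.- x n)))
             (cong ∣_∣ (ℚ.neg-distrib-+ (x m) (ℚ.- x n))))
      (p m n N≤m N≤n)

  eventually-bounded : ∀ x → IsCauchy x →
    ∃[ B ] (0ℚ ℚ.< B × ∃[ N ] (∀ n → N ℕ.≤ n → ∣ x n ∣ ℚ.≤ B))
  eventually-bounded x cx with cx 1ℚ (ℚ.positive⁻¹ 1ℚ)
  ... | N , p = 1ℚ ℚ.+ ∣ x N ∣
              , ℚ.+-mono-<-≤ (ℚ.positive⁻¹ 1ℚ) (ℚ.0≤∣p∣ (x N))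
              , N , λ n N≤n → begin
      ∣ x n ∣                         ≡⟨ cong ∣_∣ (sym (cancel (x n) (x N))) ⟩
      ∣ (x n ℚ.- x N) ℚ.+ x N ∣       ≤⟨ ℚ.∣p+q∣≤∣p∣+∣q∣ (x n ℚ.- x N) (x N) ⟩
      ∣ x n ℚ.- x N ∣ ℚ.+ ∣ x N ∣
        ≤⟨ ℚ.+-monoˡ-≤ ∣ x N ∣ (ℚ.<⇒≤ (p n N N≤n ℕ.≤-refl)) ⟩
      1ℚ ℚ.+ ∣ x N ∣ ∎
    where
    open ℚ.≤-Reasoning
    cancel : ∀ a b → (a ℚ.- b) ℚ.+ b ≡ a
    cancel = solve 2 (λ a b → (a :- b) :+ b := a) refl
      where open +-*-Solver

  *-bound : ∀ {B δ} → 0ℚ ℚ.< B → 0ℚ ℚ.< δ →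
    ∃[ η ] (0ℚ ℚ.< η ×
      (∀ a b → ∣ a ∣ ℚ.≤ B → ∣ b ∣ ℚ.< η → ∣ a ℚ.* b ∣ ℚ.< δ))
  *-bound {B} {δ} 0<B 0<δ = B⁻¹ ℚ.* δ , 0<η , λ a b a≤B b<η → begin-strict
      ∣ a ℚ.* b ∣          ≡⟨ ℚ.∣p*q∣≡∣p∣*∣q∣ a b ⟩
      ∣ a ∣ ℚ.* ∣ b ∣
        ≤⟨ ℚ.*-monoʳ-≤-nonNeg ∣ b ∣ {{ℚ.nonNegative (ℚ.0≤∣p∣ b)}} a≤B ⟩
      B ℚ.* ∣ b ∣          <⟨ ℚ.*-monoʳ-<-pos B b<η ⟩
      B ℚ.* (B⁻¹ ℚ.* δ)    ≡⟨ sym (ℚ.*-assoc B B⁻¹ δ) ⟩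
      (B ℚ.* B⁻¹) ℚ.* δ    ≡⟨ cong (ℚ._* δ) (ℚ.*-inverseʳ B) ⟩
      1ℚ ℚ.* δ             ≡⟨ ℚ.*-identityˡ δ ⟩
      δ ∎
    where
    open ℚ.≤-Reasoning
    instance
      B-pos : ℚ.Positive B
      B-pos = ℚ.positive 0<B
      B-nonZero : ℚ.NonZero B
      B-nonZero = ℚ.pos⇒nonZero B
    B⁻¹ : ℚ
    B⁻¹ = 1/ B
    0<η : 0ℚ ℚ.< B⁻¹ ℚ.* δ
    0<η = subst (ℚ._< B⁻¹ ℚ.* δ) (ℚ.*-zeroʳ B⁻¹)
            (ℚ.*-monoʳ-<-pos B⁻¹ {{ℚ.1/pos⇒pos B}} 0<δ)

  *-split : ∀ a b c d →
    a ℚ.* b ℚ.- c ℚ.* d ≡ a ℚ.* (b ℚ.- d) ℚ.+ d ℚ.* (a ℚ.- c)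
  *-split = solve 4 (λ a b c d →
    a :* b :- c :* d := a :* (b :- d) :+ d :* (a :- c)) refl
    where open +-*-Solver

  *-cauchy : ∀ x y → IsCauchy x → IsCauchy y → IsCauchy (λ n → x n ℚ.* y n)
  *-cauchy x y cx cy δ 0<δ =
    let B , 0<B , N₁ , x≤B = eventually-bounded x cx
        C , 0<C , N₂ , y≤C = eventually-bounded y cy
        η , 0<η , xη       = *-bound 0<B (half δ 0<δ)
        θ , 0<θ , yθ       = *-bound 0<C (half δ 0<δ)
        N₃ , p             = cy η 0<η
        N₄ , q             = cx θ 0<θ
        M₁                 = N₁ ℕ.⊔ N₂
        M₂                 = N₃ ℕ.⊔ N₄
    in M₁ ℕ.⊔ M₂ , λ m n M≤m M≤n →
      let M₁≤m = ℕ.m⊔n≤o⇒m≤o M₁ M₂ M≤m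
          M₂≤m = ℕ.m⊔n≤o⇒n≤o M₁ M₂ M≤m
          M₁≤n = ℕ.m⊔n≤o⇒m≤o M₁ M₂ M≤n
          M₂≤n = ℕ.m⊔n≤o⇒n≤o M₁ M₂ M≤n
      in combine m n
        (xη (x m) (y m ℚ.- y n) (x≤B m (ℕ.m⊔n≤o⇒m≤o N₁ N₂ M₁≤m))
            (p m n (ℕ.m⊔n≤o⇒m≤o N₃ N₄ M₂≤m) (ℕ.m⊔n≤o⇒m≤o N₃ N₄ M₂≤n)))
        (yθ (y n) (x m ℚ.- x n) (y≤C n (ℕ.m⊔n≤o⇒n≤o N₁ N₂ M₁≤n))
            (q m n (ℕ.m⊔n≤o⇒n≤o N₃ N₄ M₂≤m) (ℕ.m⊔n≤o⇒n≤o N₃ N₄ M₂≤n)))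
    where
    open ℚ.≤-Reasoning
    combine : ∀ m n →
      ∣ x m ℚ.* (y m ℚ.- y n) ∣ ℚ.< ½ ℚ.* δ →
      ∣ y n ℚ.* (x m ℚ.- x n) ∣ ℚ.< ½ ℚ.* δ →
      ∣ x m ℚ.* y m ℚ.- x n ℚ.* y n ∣ ℚ.< δ
    combine m n h k = begin-strict
      ∣ x m ℚ.* y m ℚ.- x n ℚ.* y n ∣
        ≡⟨ cong ∣_∣ (*-split (x m) (y m) (x n) (y n)) ⟩
      ∣ x m ℚ.* (y m ℚ.- y n) ℚ.+ y n ℚ.* (x m ℚ.- x n) ∣
        ≤⟨ ℚ.∣p+q∣≤∣p∣+∣q∣ (x m ℚ.* (y m ℚ.- y n)) (y n ℚ.* (x m ℚ.- x n)) ⟩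
      ∣ x m ℚ.* (y m ℚ.- y n) ∣ ℚ.+ ∣ y n ℚ.* (x m ℚ.- x n) ∣
        <⟨ ℚ.+-mono-< h k ⟩
      ½ ℚ.* δ ℚ.+ ½ ℚ.* δ
        ≡⟨ halves δ ⟩
      δ ∎

ℝ-rawRing : RawRing 0ℓ 0ℓ
ℝ-rawRing = record
  { Carrier = ℝ
  ; _≈_     = _≈ℝ_
  ; _+_     = λ x y → mkℝ (λ n → seq x n ℚ.+ seq y n) (+-cauchy (seq x) (seq y) (cauchy x) (cauchy y))
  ; _*_     = λ x y → mkℝ (λ n → seq x n ℚ.* seq y n) (*-cauchy (seq x) (seq y) (cauchy x) (cauchy y))
  ; -_      = λ x → mkℝ (λ n → ℚ.- seq x n) (neg-cauchy (seq x) (cauchy x))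
  ; 0#      = mkℝ (λ _ → 0ℚ) (const-cauchy 0ℚ)
  ; 1#      = mkℝ (λ _ → 1ℚ) (const-cauchy 1ℚ)
  }

module ℝ-ring = RawRing ℝ-rawRing

------------------------------------------------------------------------
-- Complex numbers

record ℂ : Set where
  constructor _+i_
  field
    re : ℝ
    im : ℝ

open ℂ public

ℂ-rawRing : RawRing 0ℓ 0ℓ
ℂ-rawRing = record
  { Carrier = ℂ
  ; _≈_     = λ z w → (re z ≈ re w) × (im z ≈ im w)
  ; _+_     = λ z w → (re z + re w) +i (im z + im w)
  ; _*_     = λ z w → (re z * re w + - (im z * im w)) +i (re z * im w + im z * re w)
  ; -_      = λ z → (- re z) +i (- im z)
  ; 0#      = 0# +i 0#
  ; 1#      = 1# +i 0#
  }
  where open ℝ-ring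

module ℂ-ring where
  open RawRing ℂ-rawRing public
  open RawSemiringDefs rawSemiring public using (_^_)

∣_∣² : ℂ → ℝ
∣ z ∣² = re z * re z + im z * im z
  where open ℝ-ring

-- |z| is the nonnegative square root of ∣ z ∣², so |z| = 1 unfolds to ∣ z ∣² = 1.
record 𝕋 : Set where
  field
    val     : ℂ
    modulus : ∣ val ∣² ℝ-ring.≈ ℝ-ring.1#

open 𝕋 public

------------------------------------------------------------------------
-- R[t]: lists of coefficients, constant term first, trailing zeros being
-- immaterial.

module Polynomials {c ℓ} (R : RawRing c ℓ) where
  open RawRing R

  coeff : List Carrier → ℕ → Carrier
  coeff []      _       = 0#
  coeff (a ∷ p) zero    = a
  coeff (a ∷ p) (suc k) = coeff p k

  infixl 6 _+ₚ_
  infixl 7 _*ₚ_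

  _+ₚ_ : List Carrier → List Carrier → List Carrier
  []      +ₚ q       = q
  (a ∷ p) +ₚ []      = a ∷ p
  (a ∷ p) +ₚ (b ∷ q) = (a + b) ∷ (p +ₚ q)

  _*ₚ_ : List Carrier → List Carrier → List Carrier
  []      *ₚ q = []
  (a ∷ p) *ₚ q = map (a *_) q +ₚ (0# ∷ (p *ₚ q))

  constant : Carrier → List Carrier
  constant a = a ∷ []

  indeterminate : List Carrier
  indeterminate = 0# ∷ 1# ∷ []

  polynomialRawRing : RawRing c ℓ
  polynomialRawRing = record
    { Carrier = List Carrier
    ; _≈_     = λ p q → ∀ k → coeff p k ≈ coeff q k
    ; _+_     = _+ₚ_
    ; _*_     = _*ₚ_
    ; -_      = map (-_)
    ; 0#      = []
    ; 1#      = constant 1#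
    }

------------------------------------------------------------------------
-- Matrices

Matrix : ∀ {c} → Set c → ℕ → Set c
Matrix A n = Fin n → Fin n → A

module Matrices {c ℓ} (R : RawRing c ℓ) where
  open RawRing R
  open RawSemiringDefs rawSemiring using (sum; _^_)

  diag : ∀ {n} → (Fin n → Carrier) → Matrix Carrier n
  diag d i j = if does (i ≟ᶠ j) then d i else 0#

  infixl 6 _⊕_ _⊖_

  _⊕_ _⊖_ : ∀ {n} → Matrix Carrier n → Matrix Carrier n → Matrix Carrier n
  (M ⊕ N) i j = M i j + N i j
  (M ⊖ N) i j = M i j + - N i j

  -- Cofactor expansion along the first row.
  det : ∀ {n} → Matrix Carrier n → Carrier
  det {zero}  M = 1#
  det {suc n} M = sum λ j →
    (- 1#) ^ toℕ j * (M zero j * det (λ i k → M (suc i) (punchIn j k)))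

  IsEigenvalue : ∀ {n} → Matrix Carrier n → Carrier → Set (c ⊔ ℓ)
  IsEigenvalue {n} M μ = Σ[ x ∈ (Fin n → Carrier) ]
    ¬ (∀ i → x i ≈ 0#) × (∀ i → sum (λ j → M i j * x j) ≈ μ * x i)

module CharacteristicPolynomial {c ℓ} (R : RawRing c ℓ) where
  open RawRing R using (Carrier)
  open Polynomials R
  open Matrices polynomialRawRing using (diag; _⊖_; det)

  charPoly : ∀ {n} → Matrix Carrier n → List Carrier
  charPoly M = det (diag (λ _ → indeterminate) ⊖ (λ i j → constant (M i j)))

  Cospectral : ∀ {n} → Matrix Carrier n → Matrix Carrier n → Set ℓ
  Cospectral M N = charPoly M ≈ charPoly N
    where open RawRing polynomialRawRing using (_≈_)

------------------------------------------------------------------------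
-- Digraphs

record Digraph (n : ℕ) : Set where
  field
    arc    : Fin n → Fin n → Bool
    noLoop : ∀ i → ¬ T (arc i i)

  Arc : Fin n → Fin n → Set
  Arc i j = T (arc i j)

  out-neighbours : Fin n → Subset n
  out-neighbours i = Vec.tabulate (arc i)

  deg⁺ : Fin n → ℕ
  deg⁺ i = card (out-neighbours i)

  DirectedWalk : Fin n → Fin n → Set
  DirectedWalk = Star Arc

  vertices : ∀ {i j} → DirectedWalk i j → List (Fin n)
  vertices {i} ε       = i ∷ []
  vertices {i} (_ ◅ w) = i ∷ vertices w

  -- All vertices of a walk except its terminal one.
  tails : ∀ {i j} → DirectedWalk i j → List (Fin n)
  tails     ε       = []
  tails {i} (_ ◅ w) = i ∷ tails w

  walkLength : ∀ {i j} → DirectedWalk i j → ℕ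
  walkLength ε       = 0
  walkLength (_ ◅ w) = suc (walkLength w)

  DirectedPath : Fin n → Fin n → Set
  DirectedPath i j = Σ[ w ∈ DirectedWalk i j ] Unique (vertices w)

  StronglyConnected : Set
  StronglyConnected = ∀ i j → DirectedPath i j

  record DirectedCycle : Set where
    field
      base       : Fin n
      walk       : DirectedWalk base base
      nontrivial : 2 ℕ.≤ walkLength walk
      distinct   : Unique (tails walk)

------------------------------------------------------------------------
-- 𝕋-gain digraphs

record GainDigraph (n : ℕ) : Set where
  field
    digraph : Digraph n

  open Digraph digraph public

  field
    φ : ∀ {i j} → Arc i j → 𝕋

open Matrices ℂ-rawRing public using (IsEigenvalue)
open CharacteristicPolynomial ℂ-rawRing public using (Cospectral)

entry : (b : Bool) → (T b → ℂ) → ℂ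
entry true  g = g tt
entry false g = ℂ-ring.0#

module _ {n : ℕ} (D : Digraph n) where
  open Digraph D
  open Matrices ℂ-rawRing
  open ℂ-ring
  open RawSemiringDefs rawSemiring using () renaming (_×_ to _·_)

  -- The matrix whose (i , j) entry is the weight of the arc from i to j,
  -- and 0 when there is no such arc.
  weightedAdjacency : (∀ {i j} → Arc i j → ℂ) → Matrix ℂ n
  weightedAdjacency f i j = entry (arc i j) f

  outDegreeMatrix : Matrix ℂ n
  outDegreeMatrix = diag (λ i → deg⁺ i · 1#)

  laplacian : Matrix ℂ n
  laplacian = outDegreeMatrix ⊖ weightedAdjacency (λ _ → 1#)

module _ {n : ℕ} (Φ : GainDigraph n) where
  open GainDigraph Φ
  open Matrices ℂ-rawRing
  open ℂ-ring

  gainAdjacency : Matrix ℂ n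
  gainAdjacency = weightedAdjacency digraph (λ a → val (φ a))

  signlessLaplacian : Matrix ℂ n
  signlessLaplacian = outDegreeMatrix digraph ⊕ gainAdjacency

  walkGain : ∀ {i j} → DirectedWalk i j → ℂ
  walkGain ε       = 1#
  walkGain (a ◅ w) = val (φ a) * walkGain w

  CycleAntibalanced : Set
  CycleAntibalanced = ∀ (C : DirectedCycle) → let open DirectedCycle C in
    walkGain walk ≈ (- 1#) ^ walkLength walk

{-# OPTIONS --safe #-}
module Submission where

open import Algebra.Bundles using (CommutativeRing; RawRing)
import Algebra.Definitions.RawSemiring as RawSemiringDefs
import Algebra.Properties.CommutativeMonoid.Sum as CommutativeMonoidSum
import Algebra.Properties.CommutativeSemigroup as CommutativeSemigroupProperties
import Algebra.Properties.Group as GroupProperties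
import Algebra.Properties.Ring as RingProperties
import Algebra.Properties.Semiring.Sum as SemiringSum
open import Algebra.Structures using (IsCommutativeRing)
open import Data.Bool.Base using (Bool; true; false; T; if_then_else_)
open import Data.Fin.Base using (Fin; zero; suc; toℕ; punchIn)
open import Data.Fin.Properties using () renaming (_≟_ to _≟ᶠ_)
open import Data.Fin.Subset using () renaming (∣_∣ to card)
open import Data.List.Base using (List; []; _∷_; _++_; map)
import Data.List.Membership.DecPropositional as DecMembership
open import Data.List.Membership.Propositional using (_∈_; _∉_)
open import Data.List.Relation.Binary.Pointwise as Pointwise using (Pointwise; []; _∷_)
open import Data.List.Relation.Unary.All as All using ([]; _∷_)
import Data.List.Relation.Unary.All.Properties as All
open import Data.List.Relation.Unary.AllPairs using ([]; _∷_)
open import Data.List.Relation.Unary.Any using (here; there)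
open import Data.List.Relation.Unary.Unique.Propositional using (Unique)
open import Data.Nat.Base as ℕ using (ℕ; zero; suc; NonZero; z≤n; s≤s)
import Data.Nat.Properties as ℕ
open import Data.Product.Base using (_×_; _,_; proj₁; proj₂; Σ-syntax; ∃-syntax)
open import Data.Rational.Base as ℚ using (ℚ; 0ℚ; 1ℚ; ½; ∣_∣; 1/_)
import Data.Rational.Properties as ℚ
open import Data.Rational.Solver using (module +-*-Solver)
open import Data.Sum.Base using (_⊎_; inj₁; inj₂)
open import Data.Unit.Base using (tt)
import Data.Vec.Base as Vec
open import Function.Base using (_∘_)
open import Function.Bundles using (_⇔_; mk⇔)
open import Level using (0ℓ)
open import Relation.Binary.Construct.Closure.ReflexiveTransitive using (ε; _◅_; _◅◅_)
open import Relation.Binary.PropositionalEquality as ≡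
  using (_≡_; _≢_; refl; cong; subst)
import Relation.Binary.Reasoning.Setoid as ≈-Reasoning
open import Relation.Nullary.Decidable using (Dec; does; yes; no)
open import Relation.Nullary.Negation using (¬_; Stable; contradiction)
open import Defs

-- Give every walk the product of the numbers −φ(a) over its arcs; Φ is cycle
-- antibalanced iff every directed cycle has weight 1.
--
-- If Q(Φ)x = 0 with x ≠ 0, pick i with |x_i| maximal. For an arc i → j,
--   2 Re(conj(x_i)(x_i + φ x_j)) = |x_i + φ x_j|² + (|x_i|² − |x_j|²) ≥ 0,
-- and by row i these terms sum to 0, so x_i = −φ x_j and |x_j| is maximal too.
-- Strong connectivity spreads this to all arcs, and a cycle through j has
-- weight · x_j = x_j. Equality of reals is ¬¬-stable, which makes the choice of
-- a maximal i harmless.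
--
-- Conversely, if all cycles have weight 1, erasing loops shows that the weight
-- of a walk depends only on its endpoints. With r fixed, x_i = weight(i → r) is
-- a null vector, and conjugation by diag(x) carries L(D) to Q(Φ).

-- Real numbers

-- `x ≈ℝ y` unfolds to `Null` of the difference sequence, so each law of real arithmetic reduces to
-- a closure property of null sequences.
Null : (ℕ → ℚ) → Set
Null d = ∀ δ → 0ℚ ℚ.< δ → ∃[ N ] (∀ n → N ℕ.≤ n → ∣ d n ∣ ℚ.< δ)

p≡p-q+q : ∀ p q → p ≡ (p ℚ.- q) ℚ.+ q
p≡p-q+q = solve 2 (λ a b → a := (a :- b) :+ b) refl
  where open +-*-Solver

*-pos : ∀ {p q} → 0ℚ ℚ.< p → 0ℚ ℚ.< q → 0ℚ ℚ.< p ℚ.* q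
*-pos {p} {q} 0<p 0<q = subst (ℚ._< p ℚ.* q) (ℚ.*-zeroʳ p)
  (ℚ.*-monoʳ-<-pos p {{ℚ.positive 0<p}} 0<q)

½-pos : ∀ {δ} → 0ℚ ℚ.< δ → 0ℚ ℚ.< ½ ℚ.* δ
½-pos = *-pos (ℚ.positive⁻¹ ½)

½+½ : ∀ δ → ½ ℚ.* δ ℚ.+ ½ ℚ.* δ ≡ δ
½+½ δ = ≡.trans (≡.sym (ℚ.*-distribʳ-+ δ ½ ½)) (ℚ.*-identityˡ δ)

null-squeeze : ∀ {d e} → Null d → (∀ n → ∣ e n ∣ ℚ.≤ ∣ d n ∣) → Null e
null-squeeze d→0 e≤d δ 0<δ with N , p ← d→0 δ 0<δ =
  N , λ n N≤n → ℚ.≤-<-trans (e≤d n) (p n N≤n)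

null-cong : ∀ {d e} → (∀ n → d n ≡ e n) → Null d → Null e
null-cong d≗e d→0 =
  null-squeeze d→0 λ n → ℚ.≤-reflexive (cong ∣_∣ (≡.sym (d≗e n)))

null-+ : ∀ {d e} → Null d → Null e → Null (λ n → d n ℚ.+ e n)
null-+ {d} {e} d→0 e→0 δ 0<δ
  with N , p ← d→0 _ (½-pos 0<δ) | M , q ← e→0 _ (½-pos 0<δ) =
  N ℕ.⊔ M , λ n N⊔M≤n → begin-strict
    ∣ d n ℚ.+ e n ∣       ≤⟨ ℚ.∣p+q∣≤∣p∣+∣q∣ (d n) (e n) ⟩
    ∣ d n ∣ ℚ.+ ∣ e n ∣   <⟨ ℚ.+-mono-< (p n (ℕ.m⊔n≤o⇒m≤o N M N⊔M≤n))
                                        (q n (ℕ.m⊔n≤o⇒n≤o N M N⊔M≤n)) ⟩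
    ½ ℚ.* δ ℚ.+ ½ ℚ.* δ   ≡⟨ ½+½ δ ⟩
    δ                     ∎
  where open ℚ.≤-Reasoning

null-neg : ∀ {d} → Null d → Null (λ n → ℚ.- d n)
null-neg {d} d→0 = null-squeeze d→0 λ n → ℚ.≤-reflexive (ℚ.∣-p∣≡∣p∣ (d n))

cauchy⇒bounded : ∀ (x : ℝ) →
  ∃[ B ] (0ℚ ℚ.< B × ∃[ N ] (∀ n → N ℕ.≤ n → ∣ seq x n ∣ ℚ.≤ B))
cauchy⇒bounded x with N , p ← cauchy x 1ℚ (ℚ.positive⁻¹ 1ℚ) =
    1ℚ ℚ.+ ∣ seq x N ∣
  , ℚ.+-mono-<-≤ (ℚ.positive⁻¹ 1ℚ) (ℚ.0≤∣p∣ (seq x N))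
  , N , λ n N≤n → begin
      ∣ seq x n ∣
        ≡⟨ cong ∣_∣ (p≡p-q+q (seq x n) (seq x N)) ⟩
      ∣ (seq x n ℚ.- seq x N) ℚ.+ seq x N ∣
        ≤⟨ ℚ.∣p+q∣≤∣p∣+∣q∣ (seq x n ℚ.- seq x N) (seq x N) ⟩
      ∣ seq x n ℚ.- seq x N ∣ ℚ.+ ∣ seq x N ∣
        ≤⟨ ℚ.+-monoˡ-≤ ∣ seq x N ∣ (ℚ.<⇒≤ (p n N N≤n ℕ.≤-refl)) ⟩
      1ℚ ℚ.+ ∣ seq x N ∣ ∎
  where
  open ℚ.≤-Reasoning

divide : ∀ {B} δ → 0ℚ ℚ.< B → 0ℚ ℚ.< δ → ∃[ η ] (0ℚ ℚ.< η × B ℚ.* η ≡ δ)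
divide {B} δ 0<B 0<δ =
    1/ B ℚ.* δ
  , *-pos (ℚ.positive⁻¹ (1/ B) {{ℚ.1/pos⇒pos B}}) 0<δ
  , (begin
      B ℚ.* (1/ B ℚ.* δ)    ≡⟨ ℚ.*-assoc B (1/ B) δ ⟨
      (B ℚ.* 1/ B) ℚ.* δ    ≡⟨ cong (ℚ._* δ) (ℚ.*-inverseʳ B) ⟩
      1ℚ ℚ.* δ              ≡⟨ ℚ.*-identityˡ δ ⟩
      δ                     ∎)
  where
  open ≡.≡-Reasoning
  instance
    B-pos : ℚ.Positive B
    B-pos = ℚ.positive 0<B
    B-nonZero : ℚ.NonZero B
    B-nonZero = ℚ.pos⇒nonZero B

∣∣-*-mono-< : ∀ {a b B η} → 0ℚ ℚ.< B → ∣ a ∣ ℚ.≤ B → ∣ b ∣ ℚ.< η →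
              ∣ a ℚ.* b ∣ ℚ.< B ℚ.* η
∣∣-*-mono-< {a} {b} {B} {η} 0<B a≤B b<η = begin-strict
  ∣ a ℚ.* b ∣      ≡⟨ ℚ.∣p*q∣≡∣p∣*∣q∣ a b ⟩
  ∣ a ∣ ℚ.* ∣ b ∣  ≤⟨ ℚ.*-monoʳ-≤-nonNeg ∣ b ∣ {{ℚ.∣-∣-nonNeg b}} a≤B ⟩
  B ℚ.* ∣ b ∣      <⟨ ℚ.*-monoʳ-<-pos B {{ℚ.positive 0<B}} b<η ⟩
  B ℚ.* η          ∎
  where open ℚ.≤-Reasoning

-- A Cauchy sequence is eventually bounded by some `B`, so it suffices to make `d` smaller than the
-- `η` with `B η = δ`.
null-* : ∀ (x : ℝ) {d} → Null d → Null (λ n → seq x n ℚ.* d n)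
null-* x {d} d→0 δ 0<δ =
  let B , 0<B , M , x≤B = cauchy⇒bounded x
      η , 0<η , Bη≡δ    = divide δ 0<B 0<δ
      N , p             = d→0 η 0<η
  in N ℕ.⊔ M , λ n N⊔M≤n → subst (∣ seq x n ℚ.* d n ∣ ℚ.<_) Bη≡δ
    (∣∣-*-mono-< {seq x n} {d n} 0<B
      (x≤B n (ℕ.m⊔n≤o⇒n≤o N M N⊔M≤n)) (p n (ℕ.m⊔n≤o⇒m≤o N M N⊔M≤n)))

-- Operations on reals are pointwise, so polynomial identities over the reals can be checked in the
-- rationals at each index.
≗⇒≈ : ∀ (x y : ℝ) → (∀ n → seq x n ≡ seq y n) → x ≈ℝ y
≗⇒≈ x y x≗y δ 0<δ = 0 , λ n _ →
  subst (ℚ._< δ)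
    (≡.sym (cong ∣_∣ (≡.trans (cong (ℚ._- seq y n) (x≗y n)) (ℚ.+-inverseʳ (seq y n)))))
    0<δ

-- The commutative ring of real numbers

ℝ-commutativeRing : CommutativeRing 0ℓ 0ℓ
ℝ-commutativeRing = record { isCommutativeRing = isCommutativeRing }
  where
  open ℝ-ring using (_+_; _*_; -_; 0#; 1#; _≈_)
  open +-*-Solver

  sym : ∀ {x y} → x ≈ y → y ≈ x
  sym {x} {y} x≈y = null-cong
    (λ n → solve 2 (λ a b → :- (a :- b) := b :- a) refl (seq x n) (seq y n))
    (null-neg x≈y)

  trans : ∀ {x y z} → x ≈ y → y ≈ z → x ≈ z
  trans {x} {y} {z} x≈y y≈z = null-cong
    (λ n → solve 3 (λ a b c → (a :- b) :+ (b :- c) := a :- c) refl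
             (seq x n) (seq y n) (seq z n))
    (null-+ x≈y y≈z)

  +-cong : ∀ {x x′ y y′} → x ≈ x′ → y ≈ y′ → x + y ≈ x′ + y′
  +-cong {x} {x′} {y} {y′} x≈x′ y≈y′ = null-cong
    (λ n → solve 4 (λ a a′ b b′ →
               (a :- a′) :+ (b :- b′) := (a :+ b) :- (a′ :+ b′)) refl
             (seq x n) (seq x′ n) (seq y n) (seq y′ n))
    (null-+ x≈x′ y≈y′)

  *-cong : ∀ {x x′ y y′} → x ≈ x′ → y ≈ y′ → x * y ≈ x′ * y′
  -- The difference of the products splits as a(b - b′) + b′(a - a′), a sum of bounded multiples of
  -- null sequences.
  *-cong {x} {x′} {y} {y′} x≈x′ y≈y′ = null-cong
    (λ n → solve 4 (λ a a′ b b′ →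
               a :* (b :- b′) :+ b′ :* (a :- a′) := a :* b :- a′ :* b′) refl
             (seq x n) (seq x′ n) (seq y n) (seq y′ n))
    (null-+ (null-* x y≈y′) (null-* y′ x≈x′))

  -‿cong : ∀ {x y} → x ≈ y → - x ≈ - y
  -‿cong {x} {y} x≈y = null-cong
    (λ n → solve 2 (λ a b → :- (a :- b) := :- a :- :- b) refl (seq x n) (seq y n))
    (null-neg x≈y)

  isCommutativeRing : IsCommutativeRing _≈_ _+_ _*_ -_ 0# 1#
  isCommutativeRing = record
    { isRing = record
      { +-isAbelianGroup = record
        { isGroup = record
          { isMonoid = record
            { isSemigroup = record
              { isMagma = record
                { isEquivalence = record
                  { refl  = λ {x} → ≗⇒≈ x x λ _ → refl
                  ; sym   = λ {x} {y} → sym {x} {y}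
                  ; trans = λ {x} {y} {z} → trans {x} {y} {z}
                  }
                ; ∙-cong = λ {x} {x′} {y} {y′} → +-cong {x} {x′} {y} {y′}
                }
              ; assoc = λ x y z → ≗⇒≈ (x + y + z) (x + (y + z)) λ n →
                  ℚ.+-assoc (seq x n) (seq y n) (seq z n)
              }
            ; identity = (λ x → ≗⇒≈ (0# + x) x λ n → ℚ.+-identityˡ (seq x n))
                       , (λ x → ≗⇒≈ (x + 0#) x λ n → ℚ.+-identityʳ (seq x n))
            }
          ; inverse = (λ x → ≗⇒≈ (- x + x) 0# λ n → ℚ.+-inverseˡ (seq x n))
                    , (λ x → ≗⇒≈ (x + - x) 0# λ n → ℚ.+-inverseʳ (seq x n))
          ; ⁻¹-cong = λ {x} {y} → -‿cong {x} {y}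
          }
        ; comm = λ x y → ≗⇒≈ (x + y) (y + x) λ n → ℚ.+-comm (seq x n) (seq y n)
        }
      ; *-cong = λ {x} {x′} {y} {y′} → *-cong {x} {x′} {y} {y′}
      ; *-assoc = λ x y z → ≗⇒≈ (x * y * z) (x * (y * z)) λ n →
          ℚ.*-assoc (seq x n) (seq y n) (seq z n)
      ; *-identity = (λ x → ≗⇒≈ (1# * x) x λ n → ℚ.*-identityˡ (seq x n))
                   , (λ x → ≗⇒≈ (x * 1#) x λ n → ℚ.*-identityʳ (seq x n))
      ; distrib = (λ x y z → ≗⇒≈ (x * (y + z)) (x * y + x * z) λ n →
                     ℚ.*-distribˡ-+ (seq x n) (seq y n) (seq z n))
                , (λ x y z → ≗⇒≈ ((y + z) * x) (y * x + z * x) λ n →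
                     ℚ.*-distribʳ-+ (seq x n) (seq y n) (seq z n))
      }
    ; *-comm = λ x y → ≗⇒≈ (x * y) (y * x) λ n → ℚ.*-comm (seq x n) (seq y n)
    }

-- Stability of equality and absence of zero divisors

-- The positive form of "nonzero": for Cauchy sequences this is apartness from zero.
BoundedAway : (ℕ → ℚ) → Set
BoundedAway d = ∃[ δ ] (0ℚ ℚ.< δ × ∃[ N ] (∀ n → N ℕ.≤ n → δ ℚ.≤ ∣ d n ∣))

boundedAway⇒¬null : ∀ {d} → BoundedAway d → ¬ Null d
boundedAway⇒¬null (δ , 0<δ , N , p) d→0 with M , q ← d→0 δ 0<δ =
  ℚ.<-irrefl refl (ℚ.≤-<-trans (p _ (ℕ.m≤m⊔n N M)) (q _ (ℕ.m≤n⊔m N M)))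

-- Take `N` with later terms within δ/4 of each other and compare the rational `∣ d N ∣` with δ/2,
-- which is decidable. If it is smaller, all later terms are below δ; otherwise they all stay at
-- least δ/4, so `d` is bounded away from zero.
¬boundedAway⇒null : ∀ {d} → IsCauchy d → ¬ BoundedAway d → Null d
¬boundedAway⇒null {d} d-cauchy ¬away δ 0<δ
  with N , p ← d-cauchy _ (½-pos (½-pos 0<δ))
  with ∣ d N ∣ ℚ.<? ½ ℚ.* δ
... | yes dN<h = N , λ n N≤n → begin-strict
    ∣ d n ∣                          ≡⟨ cong ∣_∣ (p≡p-q+q (d n) (d N)) ⟩
    ∣ (d n ℚ.- d N) ℚ.+ d N ∣        ≤⟨ ℚ.∣p+q∣≤∣p∣+∣q∣ (d n ℚ.- d N) (d N) ⟩
    ∣ d n ℚ.- d N ∣ ℚ.+ ∣ d N ∣      <⟨ ℚ.+-mono-< (p n N N≤n ℕ.≤-refl) dN<h ⟩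
    q ℚ.+ h                          <⟨ ℚ.+-monoˡ-< h q<h ⟩
    h ℚ.+ h                          ≡⟨ ½+½ δ ⟩
    δ                                ∎
  where
  open ℚ.≤-Reasoning
  h = ½ ℚ.* δ
  q = ½ ℚ.* h
  q<h : q ℚ.< h
  q<h = begin-strict
    q          ≡⟨ ℚ.+-identityˡ q ⟨
    0ℚ ℚ.+ q   <⟨ ℚ.+-monoˡ-< q (½-pos (½-pos 0<δ)) ⟩
    q ℚ.+ q    ≡⟨ ½+½ h ⟩
    h          ∎
... | no dN≮h = contradiction (q , ½-pos (½-pos 0<δ) , N , λ n N≤n →
    ℚ.≮⇒≥ λ dn<q → ℚ.<-irrefl refl (begin-strict
      h                                ≤⟨ ℚ.≮⇒≥ dN≮h ⟩
      ∣ d N ∣                          ≡⟨ cong ∣_∣ (p≡p-q+q (d N) (d n)) ⟩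
      ∣ (d N ℚ.- d n) ℚ.+ d n ∣        ≤⟨ ℚ.∣p+q∣≤∣p∣+∣q∣ (d N ℚ.- d n) (d n) ⟩
      ∣ d N ℚ.- d n ∣ ℚ.+ ∣ d n ∣      <⟨ ℚ.+-mono-< (p N n ℕ.≤-refl N≤n) dn<q ⟩
      q ℚ.+ q                          ≡⟨ ½+½ h ⟩
      h                                ∎)) ¬away
  where
  open ℚ.≤-Reasoning
  h = ½ ℚ.* δ
  q = ½ ℚ.* h

-- If `∣ e n ∣` is at least `η`, then `∣ d n ∣ ≥ δ` would force the product to be at least `δ η`,
-- against its smallness.
null-cancel-boundedAway : ∀ {d e} → BoundedAway e → Null (λ n → d n ℚ.* e n) → Null d
null-cancel-boundedAway {d} {e} (η , 0<η , M , q) de→0 δ 0<δ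
  with N , p ← de→0 (δ ℚ.* η) (*-pos 0<δ 0<η) = N ℕ.⊔ M , λ n N⊔M≤n →
    ℚ.≰⇒> λ δ≤d → ℚ.<-irrefl refl (begin-strict
      δ ℚ.* η            ≤⟨ ℚ.*-monoʳ-≤-nonNeg η {{ℚ.nonNegative (ℚ.<⇒≤ 0<η)}} δ≤d ⟩
      ∣ d n ∣ ℚ.* η
        ≤⟨ ℚ.*-monoˡ-≤-nonNeg ∣ d n ∣ {{ℚ.∣-∣-nonNeg (d n)}}
             (q n (ℕ.m⊔n≤o⇒n≤o N M N⊔M≤n)) ⟩
      ∣ d n ∣ ℚ.* ∣ e n ∣  ≡⟨ ℚ.∣p*q∣≡∣p∣*∣q∣ (d n) (e n) ⟨
      ∣ d n ℚ.* e n ∣    <⟨ p n (ℕ.m⊔n≤o⇒m≤o N M N⊔M≤n) ⟩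
      δ ℚ.* η            ∎)
  where
  open ℚ.≤-Reasoning

≈0⇒null : ∀ {x} → x ≈ℝ ℝ-ring.0# → Null (seq x)
≈0⇒null {x} = null-cong λ n → ℚ.+-identityʳ (seq x n)

null⇒≈0 : ∀ {x} → Null (seq x) → x ≈ℝ ℝ-ring.0#
null⇒≈0 {x} = null-cong λ n → ≡.sym (ℚ.+-identityʳ (seq x n))

-- For Cauchy sequences, being null is the negation of being bounded away from zero, and negations
-- are stable.
≈ℝ-stable : ∀ x y → Stable (x ≈ℝ y)
≈ℝ-stable x y ¬¬x≈y = ¬boundedAway⇒null {λ n → seq x n ℚ.- seq y n}
  (cauchy (x ℝ-ring.+ (ℝ-ring.- y)))
  (λ away → ¬¬x≈y (boundedAway⇒¬null {λ n → seq x n ℚ.- seq y n} away))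

-- `¬ (y ≈ℝ 0)` yields apartness of `y` from zero only up to double negation; stability of the goal
-- `x ≈ℝ 0` absorbs this, and then `y` can be cancelled.
ℝ-noZeroDivisors : ∀ x y → x ℝ-ring.* y ≈ℝ ℝ-ring.0# →
                   ¬ (y ≈ℝ ℝ-ring.0#) → x ≈ℝ ℝ-ring.0#
ℝ-noZeroDivisors x y xy≈0 y≉0 = ≈ℝ-stable x ℝ-ring.0# λ x≉0 →
  y≉0 (null⇒≈0 {y} (¬boundedAway⇒null {seq y} (cauchy y) λ away →
    x≉0 (null⇒≈0 {x} (null-cancel-boundedAway {seq x} {seq y} away
      (≈0⇒null {x ℝ-ring.* y} xy≈0)))))

ℝ-1≉0 : ¬ (ℝ-ring.1# ≈ℝ ℝ-ring.0#)
ℝ-1≉0 = boundedAway⇒¬null {λ _ → 1ℚ} (1ℚ , ℚ.positive⁻¹ 1ℚ , 0 , λ _ _ → ℚ.≤-refl)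

-- Absolute value and nonnegativity

module ℝ-CR = CommutativeRing ℝ-commutativeRing

∣p∣-∣q∣≤∣p-q∣ : ∀ p q → ∣ p ∣ ℚ.- ∣ q ∣ ℚ.≤ ∣ p ℚ.- q ∣
∣p∣-∣q∣≤∣p-q∣ p q = begin
  ∣ p ∣ ℚ.- ∣ q ∣                      ≡⟨ cong (λ r → ∣ r ∣ ℚ.- ∣ q ∣) (p≡p-q+q p q) ⟩
  ∣ (p ℚ.- q) ℚ.+ q ∣ ℚ.- ∣ q ∣
    ≤⟨ ℚ.+-monoˡ-≤ (ℚ.- ∣ q ∣) (ℚ.∣p+q∣≤∣p∣+∣q∣ (p ℚ.- q) q) ⟩
  (∣ p ℚ.- q ∣ ℚ.+ ∣ q ∣) ℚ.- ∣ q ∣    ≡⟨ cancel ∣ p ℚ.- q ∣ ∣ q ∣ ⟩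
  ∣ p ℚ.- q ∣                          ∎
  where
  open ℚ.≤-Reasoning
  open +-*-Solver
  cancel : ∀ a b → (a ℚ.+ b) ℚ.- b ≡ a
  cancel = solve 2 (λ a b → (a :+ b) :- b := a) refl

∣∣p∣-∣q∣∣≤∣p-q∣ : ∀ p q → ∣ ∣ p ∣ ℚ.- ∣ q ∣ ∣ ℚ.≤ ∣ p ℚ.- q ∣
∣∣p∣-∣q∣∣≤∣p-q∣ p q with ℚ.∣p∣≡p∨∣p∣≡-p (∣ p ∣ ℚ.- ∣ q ∣)
... | inj₁ eq = subst (ℚ._≤ ∣ p ℚ.- q ∣) (≡.sym eq) (∣p∣-∣q∣≤∣p-q∣ p q)
... | inj₂ eq = ≡.subst₂ ℚ._≤_
    (≡.sym (≡.trans eq (flip-sign ∣ p ∣ ∣ q ∣)))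
    (≡.trans (cong ∣_∣ (≡.sym (flip-sign p q))) (ℚ.∣-p∣≡∣p∣ (p ℚ.- q)))
    (∣p∣-∣q∣≤∣p-q∣ q p)
  where
  open +-*-Solver
  flip-sign : ∀ a b → ℚ.- (a ℚ.- b) ≡ b ℚ.- a
  flip-sign = solve 2 (λ a b → :- (a :- b) := b :- a) refl

abs : ℝ → ℝ
abs x = mkℝ (λ n → ∣ seq x n ∣) λ δ 0<δ → let N , p = cauchy x δ 0<δ in
  N , λ m n N≤m N≤n → ℚ.≤-<-trans (∣∣p∣-∣q∣∣≤∣p-q∣ (seq x m) (seq x n)) (p m n N≤m N≤n)

-- The order is encoded as the equation |x| = x, so that it respects `≈ℝ` and is handled with null
-- sequences alone.
NonNeg : ℝ → Set
NonNeg x = abs x ≈ℝ x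

p≤∣p∣ : ∀ p → p ℚ.≤ ∣ p ∣
p≤∣p∣ p with ℚ.≤-total 0ℚ p
... | inj₁ 0≤p = ℚ.≤-reflexive (≡.sym (ℚ.0≤p⇒∣p∣≡p 0≤p))
... | inj₂ p≤0 = ℚ.≤-trans p≤0 (ℚ.0≤∣p∣ p)

0≤∣p∣-p : ∀ p → 0ℚ ℚ.≤ ∣ p ∣ ℚ.- p
0≤∣p∣-p p = subst (ℚ._≤ ∣ p ∣ ℚ.- p) (ℚ.+-inverseʳ p)
  (ℚ.+-monoˡ-≤ (ℚ.- p) (p≤∣p∣ p))

∣∣-mono-≤ : ∀ {p q} → 0ℚ ℚ.≤ p → p ℚ.≤ q → ∣ p ∣ ℚ.≤ ∣ q ∣
∣∣-mono-≤ {p} {q} 0≤p p≤q =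
  subst (ℚ._≤ ∣ q ∣) (≡.sym (ℚ.0≤p⇒∣p∣≡p 0≤p)) (ℚ.≤-trans p≤q (p≤∣p∣ q))

∣p∣*∣p∣≡p*p : ∀ p → ∣ p ∣ ℚ.* ∣ p ∣ ≡ p ℚ.* p
∣p∣*∣p∣≡p*p p with ℚ.∣p∣≡p∨∣p∣≡-p p
... | inj₁ eq rewrite eq = refl
... | inj₂ eq rewrite eq = solve 1 (λ a → :- a :* :- a := a :* a) refl p
  where open +-*-Solver

abs-cong : ∀ {x y} → x ≈ℝ y → abs x ≈ℝ abs y
abs-cong {x} {y} x≈y = null-squeeze x≈y λ n → ∣∣p∣-∣q∣∣≤∣p-q∣ (seq x n) (seq y n)

nonNeg-resp-≈ : ∀ {x y} → x ≈ℝ y → NonNeg x → NonNeg y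
nonNeg-resp-≈ {x} {y} x≈y 0≤x = begin
  abs y  ≈⟨ abs-cong {x} {y} x≈y ⟨
  abs x  ≈⟨ 0≤x ⟩
  x      ≈⟨ x≈y ⟩
  y      ∎
  where open ≈-Reasoning ℝ-CR.setoid

nonNeg-0 : NonNeg ℝ-CR.0#
nonNeg-0 = ≗⇒≈ (abs ℝ-CR.0#) ℝ-CR.0# λ _ → refl

nonNeg-square : ∀ x → NonNeg (x ℝ-CR.* x)
nonNeg-square x = ≗⇒≈ (abs (x ℝ-CR.* x)) (x ℝ-CR.* x) λ n →
  ≡.trans (ℚ.∣p*q∣≡∣p∣*∣q∣ (seq x n) (seq x n)) (∣p∣*∣p∣≡p*p (seq x n))

-- Pointwise, |x + y| - (x + y) lies between 0 and (|x| - x) + (|y| - y), whose two summands are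
-- null by assumption.
nonNeg-+ : ∀ {x y} → NonNeg x → NonNeg y → NonNeg (x ℝ-CR.+ y)
nonNeg-+ {x} {y} 0≤x 0≤y = null-squeeze (null-+ 0≤x 0≤y) λ n →
  ∣∣-mono-≤ (0≤∣p∣-p (seq x n ℚ.+ seq y n))
    (subst (∣ seq x n ℚ.+ seq y n ∣ ℚ.- (seq x n ℚ.+ seq y n) ℚ.≤_)
      (regroup ∣ seq x n ∣ ∣ seq y n ∣ (seq x n) (seq y n))
      (ℚ.+-monoˡ-≤ (ℚ.- (seq x n ℚ.+ seq y n)) (ℚ.∣p+q∣≤∣p∣+∣q∣ (seq x n) (seq y n))))
  where
  regroup : ∀ a b c d → (a ℚ.+ b) ℚ.- (c ℚ.+ d) ≡ (a ℚ.- c) ℚ.+ (b ℚ.- d)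
  regroup = solve 4 (λ a b c d → (a :+ b) :- (c :+ d) := (a :- c) :+ (b :- d)) refl
    where open +-*-Solver

-- Here |x| + |y| = x + y = 0, and |x| + |y| dominates |x| pointwise.
nonNeg-+-≈0 : ∀ {x y} → NonNeg x → NonNeg y → x ℝ-CR.+ y ≈ℝ ℝ-CR.0# → x ≈ℝ ℝ-CR.0#
nonNeg-+-≈0 {x} {y} 0≤x 0≤y x+y≈0 = null⇒≈0 {x} (null-squeeze ∣x∣+∣y∣→0 λ n →
  subst (∣ seq x n ∣ ℚ.≤_)
    (≡.sym (ℚ.0≤p⇒∣p∣≡p (ℚ.+-mono-≤ (ℚ.0≤∣p∣ (seq x n)) (ℚ.0≤∣p∣ (seq y n)))))
    (subst (ℚ._≤ ∣ seq x n ∣ ℚ.+ ∣ seq y n ∣) (ℚ.+-identityʳ ∣ seq x n ∣)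
      (ℚ.+-monoʳ-≤ ∣ seq x n ∣ (ℚ.0≤∣p∣ (seq y n)))))
  where
  ∣x∣+∣y∣→0 : Null (λ n → ∣ seq x n ∣ ℚ.+ ∣ seq y n ∣)
  ∣x∣+∣y∣→0 = ≈0⇒null {abs x ℝ-CR.+ abs y}
    (ℝ-CR.trans {abs x ℝ-CR.+ abs y} {x ℝ-CR.+ y} {ℝ-CR.0#}
      (ℝ-CR.+-cong {abs x} {x} {abs y} {y} 0≤x 0≤y) x+y≈0)

-- (|x| − x)(|x| + x) = 0, so one of the two factors vanishes.
nonNeg-total : ∀ x → ¬ ¬ (NonNeg x ⊎ NonNeg (ℝ-CR.- x))
nonNeg-total x ¬total = ¬total (inj₁ (x∙y⁻¹≈ε⇒x≈y (abs x) x
  (ℝ-noZeroDivisors (abs x - x) (abs x + x) product≈0 λ ∣x∣+x≈0 →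
    ¬total (inj₂ (0≤-x ∣x∣+x≈0)))))
  where
  open ℝ-CR using (_+_; _*_; _-_; -_; _≈_; 0#; +-group; setoid)
  open GroupProperties +-group using (inverseˡ-unique; x∙y⁻¹≈ε⇒x≈y)
  product≈0 : (abs x - x) * (abs x + x) ≈ 0#
  product≈0 = ≗⇒≈ ((abs x - x) * (abs x + x)) 0# λ n → let p = seq x n in ≡.trans
    (solve 2 (λ a b → (a :- b) :* (a :+ b) := a :* a :- b :* b) refl ∣ p ∣ p)
    (≡.trans (cong (ℚ._- p ℚ.* p) (∣p∣*∣p∣≡p*p p)) (ℚ.+-inverseʳ (p ℚ.* p)))
    where open +-*-Solver
  0≤-x : abs x + x ≈ 0# → NonNeg (- x)
  0≤-x ∣x∣+x≈0 = begin
    abs (- x)  ≈⟨ ≗⇒≈ (abs (- x)) (abs x) (λ n → ℚ.∣-p∣≡∣p∣ (seq x n)) ⟩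
    abs x      ≈⟨ inverseˡ-unique (abs x) x ∣x∣+x≈0 ⟩
    - x        ∎
    where
    open ≈-Reasoning setoid



-- Walks

module _ {n} (D : Digraph n) where
  open Digraph D

  -- Using `tails` on the left counts the junction vertex once, as the first vertex of `q`.
  vertices-◅◅ : ∀ {i j k} (p : DirectedWalk i j) (q : DirectedWalk j k) →
                vertices (p ◅◅ q) ≡ tails p ++ vertices q
  vertices-◅◅     ε       q = refl
  vertices-◅◅ {i} (a ◅ p) q = cong (i ∷_) (vertices-◅◅ p q)

  source∈vertices : ∀ {i j} (p : DirectedWalk i j) → i ∈ vertices p
  source∈vertices ε       = here refl
  source∈vertices (_ ◅ _) = here refl

  target∈vertices : ∀ {i j} (p : DirectedWalk i j) → j ∈ vertices p
  target∈vertices ε       = here refl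
  target∈vertices (_ ◅ p) = there (target∈vertices p)

  split-at : ∀ {i j k} (p : DirectedWalk i j) → k ∈ vertices p →
             Σ[ q ∈ DirectedWalk i k ] Σ[ r ∈ DirectedWalk k j ] p ≡ q ◅◅ r
  split-at ε       (here refl) = ε , ε , refl
  split-at (a ◅ p) (here refl) = ε , a ◅ p , refl
  split-at (a ◅ p) (there k∈p) with q , r , eq ← split-at p k∈p =
    a ◅ q , r , cong (a ◅_) eq

  arc⇒≢ : ∀ {i j} → Arc i j → i ≢ j
  arc⇒≢ a refl = noLoop _ a

module _ {a} {A : Set a} where

  unique-++⁻ : ∀ (xs : List A) {ys} → Unique (xs ++ ys) →
    Unique xs × Unique ys × (∀ {y} → y ∈ ys → y ∉ xs)
  unique-++⁻ []       u         = [] , u , λ _ ()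
  unique-++⁻ (x ∷ xs) (x∉ ∷ u) with uxs , uys , disjoint ← unique-++⁻ xs u =
      All.++⁻ˡ xs x∉ ∷ uxs
    , uys
    , λ { y∈ys (here refl)  → All.lookup (All.++⁻ʳ xs x∉) y∈ys refl
        ; y∈ys (there y∈xs) → disjoint y∈ys y∈xs }

-- Multiplicative weights of walks

module WalkWeights {r ℓ} (R : CommutativeRing r ℓ) {n} (D : Digraph n)
  (c : ∀ {i j} → Digraph.Arc D i j → CommutativeRing.Carrier R) where

  open CommutativeRing R hiding (refl; zero)
  open CommutativeRing R using () renaming (refl to ≈-refl)
  open Digraph D
  open DecMembership (_≟ᶠ_ {n}) using (_∈?_)
  open ≈-Reasoning setoid

  weight : ∀ {i j} → DirectedWalk i j → Carrier
  weight ε       = 1#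
  weight (a ◅ w) = c a * weight w

  weight-◅◅ : ∀ {i j k} (p : DirectedWalk i j) (q : DirectedWalk j k) →
              weight (p ◅◅ q) ≈ weight p * weight q
  weight-◅◅ ε       q = sym (*-identityˡ _)
  weight-◅◅ (a ◅ p) q = trans (*-congˡ (weight-◅◅ p q)) (sym (*-assoc _ _ _))

  module _ (cycle≈1 : ∀ (C : DirectedCycle) → weight (DirectedCycle.walk C) ≈ 1#) where

    -- The length bound for the cycle formed by an arc from `i` to `k` and a return walk: since
    -- `i ≢ k`, the return walk has at least one arc.
    nonempty : ∀ {i k} (q : DirectedWalk k i) → i ≢ k → 2 ℕ.≤ suc (walkLength q)
    nonempty ε       i≢i = contradiction refl i≢i
    nonempty (_ ◅ _) _   = s≤s (s≤s z≤n)

    shortcut : ∀ {i j k} (a : Arc i k) {p : DirectedWalk k j} →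
      Σ[ q ∈ DirectedWalk k i ] Σ[ r ∈ DirectedWalk i j ] p ≡ q ◅◅ r →
      Unique (vertices p) →
      Σ[ r ∈ DirectedWalk i j ] Unique (vertices r) × weight (a ◅ p) ≈ weight r
    shortcut {i} a (q , r , refl) p-unique = r , proj₁ (proj₂ parts) , (begin
        c a * weight (q ◅◅ r)        ≈⟨ *-congˡ (weight-◅◅ q r) ⟩
        c a * (weight q * weight r)  ≈⟨ *-assoc _ _ _ ⟨
        (c a * weight q) * weight r  ≈⟨ *-congʳ (cycle≈1 cycle) ⟩
        1# * weight r                ≈⟨ *-identityˡ _ ⟩
        weight r                     ∎)
      where
      parts : Unique (tails q) × Unique (vertices r) × (∀ {v} → v ∈ vertices r → v ∉ tails q)
      parts = unique-++⁻ (tails q) (subst Unique (vertices-◅◅ D q r) p-unique)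
      cycle : DirectedCycle
      cycle = record
        { base       = i
        ; walk       = a ◅ q
        ; nontrivial = nonempty q (arc⇒≢ D a)
        -- The cycle has tails `i ∷ tails q`; as `i` is the first vertex of `r`, it is disjoint from
        -- `tails q`.
        ; distinct   = All.¬Any⇒All¬ _ (proj₂ (proj₂ parts) (source∈vertices D r))
                         ∷ proj₁ parts
        }

    attach : ∀ {i j k} (a : Arc i k) (p : DirectedWalk k j) → Unique (vertices p) →
      Σ[ q ∈ DirectedWalk i j ] Unique (vertices q) × weight (a ◅ p) ≈ weight q
    attach {i} a p p-unique with i ∈? vertices p
    ... | no i∉p = a ◅ p , All.¬Any⇒All¬ _ i∉p ∷ p-unique , ≈-refl
    ... | yes i∈p = shortcut a (split-at D p i∈p) p-unique

    -- Built from the end of the walk: the remainder is already a path, and prepending an arc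
    -- creates at most one cycle to cut out.
    loop-erasure : ∀ {i j} (w : DirectedWalk i j) →
      Σ[ p ∈ DirectedWalk i j ] Unique (vertices p) × weight w ≈ weight p
    loop-erasure ε = ε , [] ∷ [] , ≈-refl
    loop-erasure (a ◅ w) =
      let p , p-unique , w≈p  = loop-erasure w
          q , q-unique , ap≈q = attach a p p-unique
      in q , q-unique , trans (*-congˡ w≈p) ap≈q

    -- Loop erasure leaves a path from `i` to `i`; a nonempty one would repeat `i`, so only the
    -- empty walk of weight 1 remains.
    closed⇒weight≈1 : ∀ {i} (w : DirectedWalk i i) → weight w ≈ 1#
    closed⇒weight≈1 w with loop-erasure w
    ... | ε     , _            , w≈1 = w≈1
    ... | a ◅ p , i∉p ∷ _ , _   = contradiction refl (All.lookup i∉p (target∈vertices D p))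

    module _ (connected : StronglyConnected) where

      -- A path `p` from `j` back to `i` closes both walks: `v` followed by `p`, and `p` followed by
      -- `w`, have weight 1, so `weight p` is inverse to both weights.
      weight-independent : ∀ {i j} (v w : DirectedWalk i j) → weight v ≈ weight w
      weight-independent {i} {j} v w = begin
        weight v                           ≈⟨ *-identityʳ _ ⟨
        weight v * 1#                      ≈⟨ *-congˡ (closed⇒weight≈1 (p ◅◅ w)) ⟨
        weight v * weight (p ◅◅ w)         ≈⟨ *-congˡ (weight-◅◅ p w) ⟩
        weight v * (weight p * weight w)   ≈⟨ *-assoc _ _ _ ⟨
        (weight v * weight p) * weight w   ≈⟨ *-congʳ (weight-◅◅ v p) ⟨
        weight (v ◅◅ p) * weight w         ≈⟨ *-congʳ (closed⇒weight≈1 (v ◅◅ p)) ⟩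
        1# * weight w                      ≈⟨ *-identityˡ _ ⟩
        weight w                           ∎
        where p = proj₁ (connected j i)

-- Determinants and characteristic polynomials

module Scaling {r ℓ} (R : CommutativeRing r ℓ) where

  open CommutativeRing R hiding (refl; zero)
  open CommutativeRing R using () renaming (refl to ≈-refl)
  open Polynomials rawRing using (_+ₚ_; _*ₚ_; constant; indeterminate; coeff; polynomialRawRing)
  open RawSemiringDefs (RawRing.rawSemiring rawRing) using (product)
  open RawSemiringDefs (RawRing.rawSemiring polynomialRawRing) using ()
    renaming (sum to sumₚ; _^_ to _^ₚ_)
  open RawRing polynomialRawRing using () renaming (-_ to -ₚ_; 1# to 1ₚ)
  open Matrices polynomialRawRing using (det)
  open RingProperties ring using (-‿distribʳ-*)
  open CommutativeMonoidSum *-commutativeMonoid using ()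
    renaming ( sum-remove to product-remove; ∑-distrib-+ to product-*
             ; sum-cong-≋ to product-cong; sum-replicate-zero to product-1 )
  open CommutativeSemigroupProperties *-commutativeSemigroup using (interchange)
  open ≈-Reasoning setoid

  -- Scaling a polynomial does not change the length of its coefficient list, so
  -- it can be compared coefficientwise, without the ring laws of R[t].
  infix 4 _≋[_]_

  _≋[_]_ : List Carrier → Carrier → List Carrier → Set _
  p ≋[ c ] q = Pointwise (λ a b → a ≈ c * b) p q

  ≋-resp : ∀ {c d p q} → c ≈ d → p ≋[ c ] q → p ≋[ d ] q
  ≋-resp c≈d = Pointwise.map λ a≈cb → trans a≈cb (*-congʳ c≈d)

  ≋-1 : ∀ {p} → p ≋[ 1# ] p
  ≋-1 = Pointwise.refl (sym (*-identityˡ _))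

  ≋-+ : ∀ {c p p′ q q′} → p ≋[ c ] q → p′ ≋[ c ] q′ → p +ₚ p′ ≋[ c ] q +ₚ q′
  ≋-+ []        qs        = qs
  ≋-+ (x ∷ ps) []        = x ∷ ps
  ≋-+ (x ∷ ps) (y ∷ qs) = trans (+-cong x y) (sym (distribˡ _ _ _)) ∷ ≋-+ ps qs

  ≋-map-* : ∀ {a b c d p q} → a ≈ c * b → p ≋[ d ] q → map (a *_) p ≋[ c * d ] map (b *_) q
  ≋-map-* a≈cb []        = []
  ≋-map-* a≈cb (x ∷ ps) =
    trans (*-cong a≈cb x) (interchange _ _ _ _) ∷ ≋-map-* a≈cb ps

  ≋-* : ∀ {c d p p′ q q′} → p ≋[ c ] q → p′ ≋[ d ] q′ → p *ₚ p′ ≋[ c * d ] q *ₚ q′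
  ≋-* []        qs = []
  ≋-* (x ∷ ps) qs = ≋-+ (≋-map-* x qs) (sym (zeroʳ _) ∷ ≋-* ps qs)

  ≋-sum : ∀ {n c} {f g : Fin n → List Carrier} → (∀ j → f j ≋[ c ] g j) → sumₚ f ≋[ c ] sumₚ g
  ≋-sum {zero}  f≋g = []
  ≋-sum {suc n} f≋g = ≋-+ (f≋g zero) (≋-sum (f≋g ∘ suc))

  -- `N` is diag(s) M diag(t). In the cofactor expansion, the term for column `j` collects
  -- `s zero * t j` from the entry and the remaining factors from the minor; together they give the
  -- same total factor for every `j`.
  det-scale : ∀ {n} {M N : Matrix (List Carrier) n} (s t : Fin n → Carrier) →
    (∀ i j → N i j ≋[ s i * t j ] M i j) → det N ≋[ product s * product t ] det M
  det-scale {zero}  s t N≋M = ≋-resp (sym (*-identityˡ _)) ≋-1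
  det-scale {suc n} s t N≋M = ≋-sum λ j → ≋-resp (factors j)
    -- The cofactor sign is the same on both sides, hence the factor `1#` at the front of `factors`.
    (≋-* (≋-1 {(-ₚ 1ₚ) ^ₚ toℕ j}) (≋-* (N≋M zero j)
      (det-scale (s ∘ suc) (t ∘ punchIn j) λ i k → N≋M (suc i) (punchIn j k))))
    where
    factors : ∀ j → 1# * ((s zero * t j) * (product (s ∘ suc) * product (t ∘ punchIn j)))
                    ≈ product s * product t
    factors j = begin
      1# * ((s zero * t j) * (product (s ∘ suc) * product (t ∘ punchIn j)))
        ≈⟨ *-identityˡ _ ⟩
      (s zero * t j) * (product (s ∘ suc) * product (t ∘ punchIn j))
        ≈⟨ interchange _ _ _ _ ⟩
      product s * (t j * product (t ∘ punchIn j))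
        ≈⟨ *-congˡ (product-remove t) ⟨
      product s * product t ∎

  ≋-1⇒coeff : ∀ {p q} → p ≋[ 1# ] q → ∀ k → coeff p k ≈ coeff q k
  ≋-1⇒coeff []        k       = ≈-refl
  ≋-1⇒coeff (x ∷ ps) zero    = trans x (*-identityˡ _)
  ≋-1⇒coeff (x ∷ ps) (suc k) = ≋-1⇒coeff ps k

  product-inverse : ∀ {n} (s t : Fin n → Carrier) → (∀ i → s i * t i ≈ 1#) →
                    product s * product t ≈ 1#
  product-inverse {n} s t st≈1 = begin
    product s * product t       ≈⟨ product-* s t ⟨
    product (λ i → s i * t i)   ≈⟨ product-cong st≈1 ⟩
    product {n} (λ _ → 1#)      ≈⟨ product-1 n ⟩
    1#                          ∎

  -- Invariance of the characteristic polynomial under diagonal conjugation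

  open CharacteristicPolynomial rawRing using () renaming (Cospectral to Cospectralᴿ)
  open Matrices rawRing using (diag; _⊕_; _⊖_)

  module _ {n} (d : Fin n → Carrier) (G A : Matrix Carrier n) (s t : Fin n → Carrier)
    (s∙t≈1 : ∀ i → s i * t i ≈ 1#) (G≈ : ∀ i j → G i j ≈ (s i * t j) * - A i j) where

    private
      -- The Boolean `b` stands for the test `i = j`. On the diagonal the indeterminate and the
      -- degree are unscaled, so the factor `c` has to be 1; off the diagonal both entries are
      -- constants and any `c` is allowed.
      entry-scale : ∀ b {c a g x} → (b ≡ true → c ≈ 1#) → g ≈ c * - a →
        (if b then indeterminate else []) +ₚ map -_ (constant ((if b then x else 0#) + g))
          ≋[ c ]
        (if b then indeterminate else []) +ₚ map -_ (constant ((if b then x else 0#) + - a))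
      entry-scale true  {c} {a} {g} {x} c≈1 g≈ =
        trans (+-congˡ (-‿cong (+-congˡ (trans g≈ (trans (*-congʳ (c≈1 refl)) (*-identityˡ _))))))
              (sym (trans (*-congʳ (c≈1 refl)) (*-identityˡ _)))
        ∷ sym (trans (*-congʳ (c≈1 refl)) (*-identityˡ _)) ∷ []
      entry-scale false {c} {a} {g} c≈1 g≈ = (begin
        - (0# + g)           ≈⟨ -‿cong (+-identityˡ g) ⟩
        - g                  ≈⟨ -‿cong g≈ ⟩
        - (c * - a)          ≈⟨ -‿distribʳ-* c (- a) ⟩
        c * - - a            ≈⟨ *-congˡ (-‿cong (+-identityˡ (- a))) ⟨
        c * - (0# + - a)     ∎) ∷ []

      does⇒ : ∀ {p} {P : Set p} (P? : Dec P) → does P? ≡ true → P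
      does⇒ (yes p) _ = p

    -- Conjugation by diag(s), with inverse diag(t), fixes diagonal matrices and sends `- A` to `G`;
    -- the determinant changes by the product of all `s i * t i`, which is 1.
    cospectral-scale : Cospectralᴿ (diag d ⊕ G) (diag d ⊖ A)
    cospectral-scale = ≋-1⇒coeff (≋-resp (product-inverse s t s∙t≈1)
      (det-scale s t λ i j → entry-scale (does (i ≟ᶠ j))
        (λ eq → subst (λ k → s i * t k ≈ 1#) (does⇒ (i ≟ᶠ j) eq) (s∙t≈1 i))
        (G≈ i j)))

-- Complex numbers

ℂ-≗⇒≈ : ∀ z w → (∀ n → seq (re z) n ≡ seq (re w) n) →
        (∀ n → seq (im z) n ≡ seq (im w) n) → z ℂ-ring.≈ w
ℂ-≗⇒≈ z w re≗ im≗ = ≗⇒≈ (re z) (re w) re≗ , ≗⇒≈ (im z) (im w) im≗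

ℂ-commutativeRing : CommutativeRing 0ℓ 0ℓ
ℂ-commutativeRing = record { isCommutativeRing = isCommutativeRing }
  where
  open ℂ-ring using (_+_; _*_; -_; 0#; 1#; _≈_)
  open +-*-Solver

  *-cong : ∀ {z z′ w w′} → z ≈ z′ → w ≈ w′ → z * w ≈ z′ * w′
  *-cong {z} {z′} {w} {w′} (p , q) (r , s) =
      ℝ-CR.+-cong {re z ℝ-CR.* re w} {re z′ ℝ-CR.* re w′}
        {ℝ-CR.- (im z ℝ-CR.* im w)} {ℝ-CR.- (im z′ ℝ-CR.* im w′)}
        (ℝ-CR.*-cong {re z} {re z′} {re w} {re w′} p r)
        (ℝ-CR.-‿cong {im z ℝ-CR.* im w} {im z′ ℝ-CR.* im w′}
          (ℝ-CR.*-cong {im z} {im z′} {im w} {im w′} q s))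
    , ℝ-CR.+-cong {re z ℝ-CR.* im w} {re z′ ℝ-CR.* im w′} {im z ℝ-CR.* re w} {im z′ ℝ-CR.* re w′}
        (ℝ-CR.*-cong {re z} {re z′} {im w} {im w′} p s)
        (ℝ-CR.*-cong {im z} {im z′} {re w} {re w′} q r)

  *-assoc : ∀ u v w → (u * v) * w ≈ u * (v * w)
  *-assoc u v w = ℂ-≗⇒≈ ((u * v) * w) (u * (v * w))
    (λ n → solve 6 (λ a b c d e f →
        (a :* c :- b :* d) :* e :- (a :* d :+ b :* c) :* f
        := a :* (c :* e :- d :* f) :- b :* (c :* f :+ d :* e)) refl
      (seq (re u) n) (seq (im u) n) (seq (re v) n) (seq (im v) n) (seq (re w) n) (seq (im w) n))
    (λ n → solve 6 (λ a b c d e f →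
        (a :* c :- b :* d) :* f :+ (a :* d :+ b :* c) :* e
        := a :* (c :* f :+ d :* e) :+ b :* (c :* e :- d :* f)) refl
      (seq (re u) n) (seq (im u) n) (seq (re v) n) (seq (im v) n) (seq (re w) n) (seq (im w) n))

  *-comm : ∀ u v → u * v ≈ v * u
  *-comm u v = ℂ-≗⇒≈ (u * v) (v * u)
    (λ n → solve 4 (λ a b c d → a :* c :- b :* d := c :* a :- d :* b) refl
      (seq (re u) n) (seq (im u) n) (seq (re v) n) (seq (im v) n))
    (λ n → solve 4 (λ a b c d → a :* d :+ b :* c := c :* b :+ d :* a) refl
      (seq (re u) n) (seq (im u) n) (seq (re v) n) (seq (im v) n))

  *-identityˡ : ∀ z → 1# * z ≈ z
  *-identityˡ z = ℂ-≗⇒≈ (1# * z) z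
    (λ n → solve 2 (λ a b → con 1ℚ :* a :- con 0ℚ :* b := a) refl
      (seq (re z) n) (seq (im z) n))
    (λ n → solve 2 (λ a b → con 1ℚ :* b :+ con 0ℚ :* a := b) refl
      (seq (re z) n) (seq (im z) n))

  distribˡ : ∀ u v w → u * (v + w) ≈ u * v + u * w
  distribˡ u v w = ℂ-≗⇒≈ (u * (v + w)) (u * v + u * w)
    (λ n → solve 6 (λ a b c d e f →
        a :* (c :+ e) :- b :* (d :+ f) := (a :* c :- b :* d) :+ (a :* e :- b :* f)) refl
      (seq (re u) n) (seq (im u) n) (seq (re v) n) (seq (im v) n) (seq (re w) n) (seq (im w) n))
    (λ n → solve 6 (λ a b c d e f →
        a :* (d :+ f) :+ b :* (c :+ e) := (a :* d :+ b :* c) :+ (a :* f :+ b :* e)) refl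
      (seq (re u) n) (seq (im u) n) (seq (re v) n) (seq (im v) n) (seq (re w) n) (seq (im w) n))

  trans : ∀ {u v w} → u ≈ v → v ≈ w → u ≈ w
  trans {u} {v} {w} (p , q) (r , s) =
    ℝ-CR.trans {re u} {re v} {re w} p r , ℝ-CR.trans {im u} {im v} {im w} q s

  +-cong : ∀ {z z′ w w′} → z ≈ z′ → w ≈ w′ → z + w ≈ z′ + w′
  +-cong {z} {z′} {w} {w′} (p , q) (r , s) =
      ℝ-CR.+-cong {re z} {re z′} {re w} {re w′} p r
    , ℝ-CR.+-cong {im z} {im z′} {im w} {im w′} q s

  isCommutativeRing : IsCommutativeRing _≈_ _+_ _*_ -_ 0# 1#
  isCommutativeRing = record
    { isRing = record
      { +-isAbelianGroup = record
        { isGroup = record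
          { isMonoid = record
            { isSemigroup = record
              { isMagma = record
                { isEquivalence = record
                  { refl  = λ {z} → ℝ-CR.refl {re z} , ℝ-CR.refl {im z}
                  ; sym   = λ {z} {w} (p , q) →
                              ℝ-CR.sym {re z} {re w} p , ℝ-CR.sym {im z} {im w} q
                  ; trans = λ {u} {v} {w} → trans {u} {v} {w}
                  }
                ; ∙-cong = λ {z} {z′} {w} {w′} → +-cong {z} {z′} {w} {w′}
                }
              ; assoc = λ u v w → ℝ-CR.+-assoc (re u) (re v) (re w)
                                , ℝ-CR.+-assoc (im u) (im v) (im w)
              }
            ; identity = (λ z → ℝ-CR.+-identityˡ (re z) , ℝ-CR.+-identityˡ (im z))
                       , (λ z → ℝ-CR.+-identityʳ (re z) , ℝ-CR.+-identityʳ (im z))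
            }
          ; inverse = (λ z → ℝ-CR.-‿inverseˡ (re z) , ℝ-CR.-‿inverseˡ (im z))
                    , (λ z → ℝ-CR.-‿inverseʳ (re z) , ℝ-CR.-‿inverseʳ (im z))
          ; ⁻¹-cong = λ {z} {w} (p , q) →
              ℝ-CR.-‿cong {re z} {re w} p , ℝ-CR.-‿cong {im z} {im w} q
          }
        ; comm = λ z w → ℝ-CR.+-comm (re z) (re w) , ℝ-CR.+-comm (im z) (im w)
        }
      ; *-cong = λ {z} {z′} {w} {w′} → *-cong {z} {z′} {w} {w′}
      ; *-assoc = *-assoc
      ; *-identity = *-identityˡ
                   , λ z → trans {z * 1#} {1# * z} {z} (*-comm z 1#) (*-identityˡ z)
      ; distrib = distribˡ , λ u v w →
          trans {(v + w) * u} {u * (v + w)} {v * u + w * u} (*-comm (v + w) u)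
            (trans {u * (v + w)} {u * v + u * w} {v * u + w * u} (distribˡ u v w)
              (+-cong {u * v} {v * u} {u * w} {w * u} (*-comm u v) (*-comm u w)))
      }
    ; *-comm = *-comm
    }

module ℂ-CR = CommutativeRing ℂ-commutativeRing

ℂ-stable : ∀ z w → Stable (z ℂ-CR.≈ w)
ℂ-stable z w ¬¬z≈w =
    ≈ℝ-stable (re z) (re w) (λ ¬p → ¬¬z≈w (¬p ∘ proj₁))
  , ≈ℝ-stable (im z) (im w) (λ ¬p → ¬¬z≈w (¬p ∘ proj₂))

-- Squared modulus and the real inner product on the complex plane

square≈0 : ∀ x → x ℝ-CR.* x ≈ℝ ℝ-CR.0# → x ≈ℝ ℝ-CR.0#
square≈0 x xx≈0 = ≈ℝ-stable x ℝ-CR.0# λ x≉0 → x≉0 (ℝ-noZeroDivisors x x xx≈0 x≉0)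

nonNeg-∣∣² : ∀ z → NonNeg ∣ z ∣²
nonNeg-∣∣² z = nonNeg-+ {re z ℝ-CR.* re z} {im z ℝ-CR.* im z}
  (nonNeg-square (re z)) (nonNeg-square (im z))

∣z∣²≈0⇒z≈0 : ∀ z → ∣ z ∣² ≈ℝ ℝ-CR.0# → z ℂ-CR.≈ ℂ-CR.0#
∣z∣²≈0⇒z≈0 z ∣z∣²≈0 =
    square≈0 (re z) (nonNeg-+-≈0 {a²} {b²} 0≤a² 0≤b² ∣z∣²≈0)
  , square≈0 (im z) (nonNeg-+-≈0 {b²} {a²} 0≤b² 0≤a²
      (ℝ-CR.trans {b² ℝ-CR.+ a²} {a² ℝ-CR.+ b²} {ℝ-CR.0#} (ℝ-CR.+-comm b² a²) ∣z∣²≈0))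
  where
  a² = re z ℝ-CR.* re z
  b² = im z ℝ-CR.* im z
  0≤a² = nonNeg-square (re z)
  0≤b² = nonNeg-square (im z)

∣∣²-cong : ∀ {z w} → z ℂ-CR.≈ w → ∣ z ∣² ≈ℝ ∣ w ∣²
∣∣²-cong {z} {w} (p , q) = ℝ-CR.+-cong
  {re z ℝ-CR.* re z} {re w ℝ-CR.* re w} {im z ℝ-CR.* im z} {im w ℝ-CR.* im w}
  (ℝ-CR.*-cong {re z} {re w} {re z} {re w} p p)
  (ℝ-CR.*-cong {im z} {im w} {im z} {im w} q q)

∣0∣²≈0 : ∣ ℂ-CR.0# ∣² ≈ℝ ℝ-CR.0#
∣0∣²≈0 = ≗⇒≈ ∣ ℂ-CR.0# ∣² ℝ-CR.0# λ _ → refl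

∣∣²-* : ∀ z w → ∣ z ℂ-CR.* w ∣² ≈ℝ ∣ z ∣² ℝ-CR.* ∣ w ∣²
∣∣²-* z w = ≗⇒≈ ∣ z ℂ-CR.* w ∣² (∣ z ∣² ℝ-CR.* ∣ w ∣²) λ n →
  solve 4 (λ a b c d →
      (a :* c :- b :* d) :* (a :* c :- b :* d) :+ (a :* d :+ b :* c) :* (a :* d :+ b :* c)
      := (a :* a :+ b :* b) :* (c :* c :+ d :* d)) refl
    (seq (re z) n) (seq (im z) n) (seq (re w) n) (seq (im w) n)
  where open +-*-Solver

-- From (u - 1)z = 0, multiplicativity of the squared modulus gives |u - 1|²|z|² = 0, which reduces
-- cancellation to the absence of real zero divisors.
ℂ-cancel : ∀ u z → u ℂ-CR.* z ℂ-CR.≈ z → ¬ ∣ z ∣² ≈ℝ ℝ-CR.0# → u ℂ-CR.≈ ℂ-CR.1#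
ℂ-cancel u z uz≈z ∣z∣²≉0 = x∙y⁻¹≈ε⇒x≈y u 1#
  (∣z∣²≈0⇒z≈0 (u - 1#) (ℝ-noZeroDivisors ∣ u - 1# ∣² ∣ z ∣² product≈0 ∣z∣²≉0))
  where
  open ℂ-CR using (_*_; _-_; -_; _+_; 1#; 0#; _≈_)
  open GroupProperties ℂ-CR.+-group using (x∙y⁻¹≈ε⇒x≈y)
  open RingProperties ℂ-CR.ring using (-1*x≈-x)
  difference≈0 : (u - 1#) * z ≈ 0#
  difference≈0 = begin
    (u - 1#) * z         ≈⟨ ℂ-CR.distribʳ z u (- 1#) ⟩
    u * z + - 1# * z     ≈⟨ ℂ-CR.+-cong {u * z} {z} { - 1# * z} { - z} uz≈z (-1*x≈-x z) ⟩
    z - z                ≈⟨ ℂ-CR.-‿inverseʳ z ⟩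
    0#                   ∎
    where open ≈-Reasoning ℂ-CR.setoid
  product≈0 : ∣ u - 1# ∣² ℝ-CR.* ∣ z ∣² ≈ℝ ℝ-CR.0#
  product≈0 = begin
    ∣ u - 1# ∣² ℝ-CR.* ∣ z ∣²  ≈⟨ ∣∣²-* (u - 1#) z ⟨
    ∣ (u - 1#) * z ∣²          ≈⟨ ∣∣²-cong {(u - 1#) * z} {0#} difference≈0 ⟩
    ∣ 0# ∣²                    ≈⟨ ∣0∣²≈0 ⟩
    ℝ-CR.0#                    ∎
    where open ≈-Reasoning ℝ-CR.setoid

-- The real part of conj(u) z.
⟪_,_⟫ : ℂ → ℂ → ℝ
⟪ u , z ⟫ = re u ℝ-CR.* re z ℝ-CR.+ im u ℝ-CR.* im z

⟪,⟫-congʳ : ∀ u {z w} → z ℂ-CR.≈ w → ⟪ u , z ⟫ ≈ℝ ⟪ u , w ⟫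
⟪,⟫-congʳ u {z} {w} (p , q) = ℝ-CR.+-cong
  {re u ℝ-CR.* re z} {re u ℝ-CR.* re w} {im u ℝ-CR.* im z} {im u ℝ-CR.* im w}
  (ℝ-CR.*-congˡ {re u} {re z} {re w} p)
  (ℝ-CR.*-congˡ {im u} {im z} {im w} q)

⟪,⟫-0ʳ : ∀ u → ⟪ u , ℂ-CR.0# ⟫ ≈ℝ ℝ-CR.0#
⟪,⟫-0ʳ u = ≗⇒≈ ⟪ u , ℂ-CR.0# ⟫ ℝ-CR.0# λ n →
  solve 2 (λ a b → a :* con 0ℚ :+ b :* con 0ℚ := con 0ℚ) refl (seq (re u) n) (seq (im u) n)
  where open +-*-Solver

⟪,⟫-+ʳ : ∀ u z w → ⟪ u , z ℂ-CR.+ w ⟫ ≈ℝ ⟪ u , z ⟫ ℝ-CR.+ ⟪ u , w ⟫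
⟪,⟫-+ʳ u z w = ≗⇒≈ ⟪ u , z ℂ-CR.+ w ⟫ (⟪ u , z ⟫ ℝ-CR.+ ⟪ u , w ⟫) λ n →
  solve 6 (λ a b c d e f →
      a :* (c :+ e) :+ b :* (d :+ f) := (a :* c :+ b :* d) :+ (a :* e :+ b :* f)) refl
    (seq (re u) n) (seq (im u) n) (seq (re z) n) (seq (im z) n) (seq (re w) n) (seq (im w) n)
  where open +-*-Solver

-- Polarization: with z = x + cy, 2⟨x, z⟩ = |z|² + |x|² - |z - x|², and |z - x| = |y| because |c| =
-- 1. The factor 2 is written as `x + x`.
∣x+cy∣² : ∀ c x y → ∣ c ∣² ≈ℝ ℝ-CR.1# →
  ⟪ x ℂ-CR.+ x , x ℂ-CR.+ c ℂ-CR.* y ⟫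
    ≈ℝ ∣ x ℂ-CR.+ c ℂ-CR.* y ∣² ℝ-CR.+ (∣ x ∣² ℝ-CR.- ∣ y ∣²)
∣x+cy∣² c x y ∣c∣²≈1 = begin
  ⟪ x ℂ-CR.+ x , z ⟫
    ≈⟨ ≗⇒≈ ⟪ x ℂ-CR.+ x , z ⟫ (∣ z ∣² + (∣ x ∣² - ∣ c ∣² * ∣ y ∣²)) identity ⟩
  ∣ z ∣² + (∣ x ∣² - ∣ c ∣² * ∣ y ∣²)
    ≈⟨ ℝ-CR.+-congˡ {∣ z ∣²} {∣ x ∣² - ∣ c ∣² * ∣ y ∣²} {∣ x ∣² - 1# * ∣ y ∣²}
         (ℝ-CR.+-congˡ {∣ x ∣²} { - (∣ c ∣² * ∣ y ∣²)} { - (1# * ∣ y ∣²)}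
           (ℝ-CR.-‿cong {∣ c ∣² * ∣ y ∣²} {1# * ∣ y ∣²}
             (ℝ-CR.*-congʳ {∣ y ∣²} {∣ c ∣²} {1#} ∣c∣²≈1))) ⟩
  ∣ z ∣² + (∣ x ∣² - 1# * ∣ y ∣²)
    ≈⟨ ℝ-CR.+-congˡ {∣ z ∣²} {∣ x ∣² - 1# * ∣ y ∣²} {∣ x ∣² - ∣ y ∣²}
         (ℝ-CR.+-congˡ {∣ x ∣²} { - (1# * ∣ y ∣²)} { - ∣ y ∣²}
           (ℝ-CR.-‿cong {1# * ∣ y ∣²} {∣ y ∣²} (ℝ-CR.*-identityˡ ∣ y ∣²))) ⟩
  ∣ z ∣² + (∣ x ∣² - ∣ y ∣²) ∎
  where
  open ℝ-CR using (_+_; _-_; -_; _*_; 1#)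
  open ≈-Reasoning ℝ-CR.setoid
  z = x ℂ-CR.+ c ℂ-CR.* y
  identity : ∀ n → seq ⟪ x ℂ-CR.+ x , z ⟫ n ≡ seq (∣ z ∣² + (∣ x ∣² - ∣ c ∣² * ∣ y ∣²)) n
  identity n = solve 6 (λ p q a b c d →
      (a :+ a) :* (a :+ (p :* c :- q :* d)) :+ (b :+ b) :* (b :+ (p :* d :+ q :* c))
      := ((a :+ (p :* c :- q :* d)) :* (a :+ (p :* c :- q :* d))
           :+ (b :+ (p :* d :+ q :* c)) :* (b :+ (p :* d :+ q :* c)))
         :+ ((a :* a :+ b :* b) :- (p :* p :+ q :* q) :* (c :* c :+ d :* d))) refl
    (seq (re c) n) (seq (im c) n) (seq (re x) n) (seq (im x) n) (seq (re y) n) (seq (im y) n)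
    where open +-*-Solver

open RawSemiringDefs (RawRing.rawSemiring ℝ-rawRing) using () renaming (sum to sumℝ)

-- The head and the sum of the tail are both nonnegative and add up to zero, so both vanish; then
-- recurse.
sum-nonNeg≈0 : ∀ {n} (f : Fin n → ℝ) → (∀ j → NonNeg (f j)) →
  sumℝ f ≈ℝ ℝ-CR.0# → ∀ j → f j ≈ℝ ℝ-CR.0#
sum-nonNeg≈0 {suc n} f 0≤f Σf≈0 = λ
  { zero    → nonNeg-+-≈0 {f zero} {sumℝ (f ∘ suc)} (0≤f zero) 0≤Σ Σf≈0
  ; (suc j) → sum-nonNeg≈0 (f ∘ suc) (0≤f ∘ suc)
      (nonNeg-+-≈0 {sumℝ (f ∘ suc)} {f zero} 0≤Σ (0≤f zero)
        (ℝ-CR.trans {sumℝ (f ∘ suc) ℝ-CR.+ f zero} {sumℝ f} {ℝ-CR.0#}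
          (ℝ-CR.+-comm (sumℝ (f ∘ suc)) (f zero)) Σf≈0)) j }
  where
  sum-nonNeg : ∀ {m} (g : Fin m → ℝ) → (∀ j → NonNeg (g j)) → NonNeg (sumℝ g)
  sum-nonNeg {zero}  g 0≤g = nonNeg-0
  sum-nonNeg {suc m} g 0≤g = nonNeg-+ {g zero} {sumℝ (g ∘ suc)} (0≤g zero)
    (sum-nonNeg (g ∘ suc) (0≤g ∘ suc))
  0≤Σ : NonNeg (sumℝ (f ∘ suc))
  0≤Σ = sum-nonNeg (f ∘ suc) (0≤f ∘ suc)

-- Maxima of finite families of reals

IsMax : ∀ {n} → (Fin n → ℝ) → Fin n → Set
IsMax f i = ∀ j → NonNeg (f i ℝ-CR.- f j)

nonNeg-x-x : ∀ x → NonNeg (x ℝ-CR.- x)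
nonNeg-x-x x = nonNeg-resp-≈ {ℝ-CR.0#} {x ℝ-CR.- x}
  (ℝ-CR.sym {x ℝ-CR.- x} {ℝ-CR.0#} (ℝ-CR.-‿inverseʳ x)) nonNeg-0

nonNeg-trans : ∀ x y z → NonNeg (x ℝ-CR.- y) → NonNeg (y ℝ-CR.- z) → NonNeg (x ℝ-CR.- z)
nonNeg-trans x y z x≥y y≥z =
  nonNeg-resp-≈ {(x ℝ-CR.- y) ℝ-CR.+ (y ℝ-CR.- z)} {x ℝ-CR.- z}
    (≗⇒≈ ((x ℝ-CR.- y) ℝ-CR.+ (y ℝ-CR.- z)) (x ℝ-CR.- z) λ n →
      solve 3 (λ a b c → (a :- b) :+ (b :- c) := a :- c) refl (seq x n) (seq y n) (seq z n))
    (nonNeg-+ {x ℝ-CR.- y} {y ℝ-CR.- z} x≥y y≥z)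
  where open +-*-Solver

-- Compare the head with a maximum of the tail. Real numbers are comparable only up to double
-- negation, hence the form of the conclusion.
¬¬-max : ∀ {n} (f : Fin (suc n) → ℝ) → ¬ ¬ (∃[ i ] IsMax f i)
¬¬-max {zero}  f ¬max = ¬max (zero , λ { zero → nonNeg-x-x (f zero) })
¬¬-max {suc n} f ¬max = ¬¬-max (f ∘ suc) λ (i , i-max) →
  nonNeg-total (f zero ℝ-CR.- f (suc i)) λ
    { (inj₁ f0≥fi) → ¬max (zero , λ
        { zero    → nonNeg-x-x (f zero)
        ; (suc j) → nonNeg-trans (f zero) (f (suc i)) (f (suc j)) f0≥fi (i-max j) })
    ; (inj₂ fi≥f0) → ¬max (suc i , λ
        { zero    → nonNeg-resp-≈ { ℝ-CR.- (f zero ℝ-CR.- f (suc i))} {f (suc i) ℝ-CR.- f zero}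
                      (flip-sign (f zero) (f (suc i))) fi≥f0
        ; (suc j) → i-max j }) }
  where
  flip-sign : ∀ x y → ℝ-CR.- (x ℝ-CR.- y) ≈ℝ y ℝ-CR.- x
  flip-sign x y = ≗⇒≈ (ℝ-CR.- (x ℝ-CR.- y)) (y ℝ-CR.- x) λ n →
    solve 2 (λ a b → :- (a :- b) := b :- a) refl (seq x n) (seq y n)
    where open +-*-Solver

-- Rows of the signless Laplacian

-- The Boolean is a variable here so that it can be matched on; it is later instantiated with
-- `arc i j`.
entry-elim : ∀ {p} (P : ℂ → Set p) b (g : T b → ℂ) → P ℂ-CR.0# → (∀ a → P (g a)) → P (entry b g)
entry-elim P true  g P0 Pg = Pg tt
entry-elim P false g P0 Pg = P0

entry-arc : ∀ b (g : T b → ℂ) (a : T b) → entry b g ≡ g a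
entry-arc true g tt = refl

module _ where
  open ℂ-CR using (_+_; _*_; 0#; 1#; _≈_; setoid)
  open RawSemiringDefs (RawRing.rawSemiring ℂ-rawRing) using () renaming (_×_ to _·_)
  open Matrices ℂ-rawRing using (diag)
  open SemiringSum ℂ-CR.semiring
    using (sum; sum-cong-≋; ∑-distrib-+; *-distribʳ-sum; sum-replicate-zero)
  open ≈-Reasoning setoid

  -- Writing the out-degree as a sum of arc indicators over all `j` lets it be merged with the
  -- adjacency row.
  card-tabulate : ∀ {n} (f : Fin n → Bool) →
    card (Vec.tabulate f) · 1# ≈ sum (λ j → entry (f j) (λ _ → 1#))
  card-tabulate {zero}  f = ℂ-CR.refl {0#}
  card-tabulate {suc n} f with f zero
  ... | true  = ℂ-CR.+-congˡ {1#} {card (Vec.tabulate (f ∘ suc)) · 1#}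
                  {sum (λ j → entry (f (suc j)) (λ _ → 1#))} (card-tabulate (f ∘ suc))
  ... | false = begin
    card (Vec.tabulate (f ∘ suc)) · 1#
      ≈⟨ card-tabulate (f ∘ suc) ⟩
    sum (λ j → entry (f (suc j)) (λ _ → 1#))
      ≈⟨ ℂ-CR.+-identityˡ (sum (λ j → entry (f (suc j)) (λ _ → 1#))) ⟨
    0# + sum (λ j → entry (f (suc j)) (λ _ → 1#)) ∎

  diag-row : ∀ {n} (d x : Fin n → ℂ) i → sum (λ j → diag d i j * x j) ≈ d i * x i
  diag-row {suc n} d x zero = begin
    d zero * x zero + sum (λ j → 0# * x (suc j))
      ≈⟨ ℂ-CR.+-congˡ {d zero * x zero} {sum (λ j → 0# * x (suc j))} {0#} tail≈0 ⟩
    d zero * x zero + 0#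
      ≈⟨ ℂ-CR.+-identityʳ (d zero * x zero) ⟩
    d zero * x zero ∎
    where
    tail≈0 : sum (λ j → 0# * x (suc j)) ≈ 0#
    tail≈0 = begin
      sum (λ j → 0# * x (suc j))
        ≈⟨ sum-cong-≋ {n} {λ j → 0# * x (suc j)} {λ _ → 0#} (λ j → ℂ-CR.zeroˡ (x (suc j))) ⟩
      sum {n} (λ _ → 0#)  ≈⟨ sum-replicate-zero n ⟩
      0#                  ∎
  diag-row {suc n} d x (suc i) = begin
    0# * x zero + rest         ≈⟨ ℂ-CR.+-congʳ {rest} {0# * x zero} {0#} (ℂ-CR.zeroˡ (x zero)) ⟩
    0# + rest                  ≈⟨ ℂ-CR.+-identityˡ rest ⟩
    rest                       ≈⟨ diag-row (d ∘ suc) (x ∘ suc) i ⟩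
    d (suc i) * x (suc i)      ∎
    where rest = sum (λ j → diag (d ∘ suc) i j * x (suc j))

  entry-combine : ∀ b (g : T b → ℂ) x y →
    entry b (λ _ → 1#) * x + entry b g * y ≈ entry b (λ a → x + g a * y)
  entry-combine true  g x y = ℂ-CR.+-congʳ {g tt * y} {1# * x} {x} (ℂ-CR.*-identityˡ x)
  entry-combine false g x y = begin
    0# * x + 0# * y   ≈⟨ ℂ-CR.distribˡ 0# x y ⟨
    0# * (x + y)      ≈⟨ ℂ-CR.zeroˡ (x + y) ⟩
    0#                ∎

  -- Each of the `deg⁺ i` copies of `x i` is assigned to one arc leaving `i`, giving one summand per
  -- arc.
  signlessLaplacian-row : ∀ {n} (Φ : GainDigraph n) (x : Fin n → ℂ) i →
    let open GainDigraph Φ in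
    sum (λ j → signlessLaplacian Φ i j * x j)
      ≈ sum (λ j → entry (arc i j) (λ a → x i + val (φ a) * x j))
  signlessLaplacian-row {n} Φ x i = begin
    sum (λ j → (Δ i j + A i j) * x j)
      ≈⟨ sum-cong-≋ {n} {λ j → (Δ i j + A i j) * x j} {λ j → Δ i j * x j + A i j * x j}
           (λ j → ℂ-CR.distribʳ (x j) (Δ i j) (A i j)) ⟩
    sum (λ j → Δ i j * x j + A i j * x j)
      ≈⟨ ∑-distrib-+ (λ j → Δ i j * x j) (λ j → A i j * x j) ⟩
    sum (λ j → Δ i j * x j) + Ax
      ≈⟨ ℂ-CR.+-congʳ {Ax} {sum (λ j → Δ i j * x j)} {sum (λ j → I j * x i)} diagonal ⟩
    sum (λ j → I j * x i) + Ax
      ≈⟨ ∑-distrib-+ (λ j → I j * x i) (λ j → A i j * x j) ⟨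
    sum (λ j → I j * x i + A i j * x j)
      ≈⟨ sum-cong-≋ {n} {λ j → I j * x i + A i j * x j}
           {λ j → entry (arc i j) (λ a → x i + val (φ a) * x j)}
           (λ j → entry-combine (arc i j) (λ a → val (φ a)) (x i) (x j)) ⟩
    sum (λ j → entry (arc i j) (λ a → x i + val (φ a) * x j)) ∎
    where
    open GainDigraph Φ
    Δ = outDegreeMatrix digraph
    A = gainAdjacency Φ
    I : Fin n → ℂ
    I j = entry (arc i j) (λ _ → 1#)
    Ax = sum (λ j → A i j * x j)
    diagonal : sum (λ j → Δ i j * x j) ≈ sum (λ j → I j * x i)
    diagonal = begin
      sum (λ j → Δ i j * x j)   ≈⟨ diag-row (λ i → deg⁺ i · 1#) x i ⟩
      (deg⁺ i · 1#) * x i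
        ≈⟨ ℂ-CR.*-congʳ {x i} {deg⁺ i · 1#} {sum I} (card-tabulate (arc i)) ⟩
      sum I * x i               ≈⟨ *-distribʳ-sum (x i) I ⟩
      sum (λ j → I j * x i)     ∎

  ⟪,⟫-sum : ∀ {n} u (z : Fin n → ℂ) → ⟪ u , sum z ⟫ ≈ℝ sumℝ (λ j → ⟪ u , z j ⟫)
  ⟪,⟫-sum {zero}  u z = ⟪,⟫-0ʳ u
  ⟪,⟫-sum {suc n} u z = ℝ-CR.trans
    {⟪ u , sum z ⟫} {⟪ u , z zero ⟫ ℝ-CR.+ ⟪ u , sum (z ∘ suc) ⟫} {sumℝ (λ j → ⟪ u , z j ⟫)}
    (⟪,⟫-+ʳ u (z zero) (sum (z ∘ suc)))
    (ℝ-CR.+-congˡ {⟪ u , z zero ⟫} {⟪ u , sum (z ∘ suc) ⟫} {sumℝ (λ j → ⟪ u , z (suc j) ⟫)}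
      (⟪,⟫-sum u (z ∘ suc)))

-- Walk gains of the opposite gain function

module Antigain {n} (Φ : GainDigraph n) where
  open GainDigraph Φ
  open ℂ-CR using (_+_; _*_; -_; 0#; 1#; _≈_; setoid)
  open ℂ-ring using (_^_)
  open RingProperties ℂ-CR.ring using (-‿distribʳ-*; -‿involutive; -1*x≈-x)
  open CommutativeSemigroupProperties ℂ-CR.*-commutativeSemigroup using (interchange)
  open SemiringSum ℂ-CR.semiring using (sum; sum-cong-≋; sum-replicate-zero)
  open WalkWeights ℂ-commutativeRing digraph (λ a → - val (φ a)) public

  -1*-z≈z : ∀ z → - 1# * - z ≈ z
  -1*-z≈z z = begin
    - 1# * - z   ≈⟨ -1*x≈-x (- z) ⟩
    - - z        ≈⟨ -‿involutive z ⟩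
    z            ∎
    where open ≈-Reasoning setoid

  -1^n*-1^n≈1 : ∀ n → (- 1#) ^ n * (- 1#) ^ n ≈ 1#
  -1^n*-1^n≈1 zero    = ℂ-CR.*-identityˡ 1#
  -1^n*-1^n≈1 (suc n) = begin
    (- 1# * (- 1#) ^ n) * (- 1# * (- 1#) ^ n)
      ≈⟨ interchange (- 1#) ((- 1#) ^ n) (- 1#) ((- 1#) ^ n) ⟩
    (- 1# * - 1#) * ((- 1#) ^ n * (- 1#) ^ n)
      ≈⟨ ℂ-CR.*-cong { - 1# * - 1#} {1#} {(- 1#) ^ n * (- 1#) ^ n} {1#}
           (-1*-z≈z 1#) (-1^n*-1^n≈1 n) ⟩
    1# * 1#                                     ≈⟨ ℂ-CR.*-identityˡ 1# ⟩
    1#                                          ∎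
    where open ≈-Reasoning setoid

  -- Every arc contributes one factor -1. Since (-1)^ℓ is its own inverse, a cycle has weight 1
  -- exactly when its gain is (-1)^ℓ.
  weight≈±walkGain : ∀ {i j} (w : DirectedWalk i j) →
    weight w ≈ (- 1#) ^ walkLength w * walkGain Φ w
  weight≈±walkGain ε       = ℂ-CR.sym {1# * 1#} {1#} (ℂ-CR.*-identityˡ 1#)
  weight≈±walkGain (a ◅ w) = begin
    - g * weight w
      ≈⟨ ℂ-CR.*-cong { - g} { - 1# * g} {weight w} {s * walkGain Φ w}
           (ℂ-CR.sym { - 1# * g} { - g} (-1*x≈-x g)) (weight≈±walkGain w) ⟩
    (- 1# * g) * (s * walkGain Φ w)   ≈⟨ interchange (- 1#) g s (walkGain Φ w) ⟩
    (- 1# * s) * (g * walkGain Φ w)   ∎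
    where
    open ≈-Reasoning setoid
    g = val (φ a)
    s = (- 1#) ^ walkLength w

  antibalanced⇒cycle≈1 : CycleAntibalanced Φ →
    ∀ (C : DirectedCycle) → weight (DirectedCycle.walk C) ≈ 1#
  antibalanced⇒cycle≈1 anti C = begin
    weight w          ≈⟨ weight≈±walkGain w ⟩
    s * walkGain Φ w  ≈⟨ ℂ-CR.*-congˡ {s} {walkGain Φ w} {s} (anti C) ⟩
    s * s             ≈⟨ -1^n*-1^n≈1 (walkLength w) ⟩
    1#                ∎
    where
    open ≈-Reasoning setoid
    w = DirectedCycle.walk C
    s = (- 1#) ^ walkLength w

  cycle≈1⇒antibalanced :
    (∀ (C : DirectedCycle) → weight (DirectedCycle.walk C) ≈ 1#) → CycleAntibalanced Φ
  cycle≈1⇒antibalanced cycle≈1 C = begin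
    g               ≈⟨ ℂ-CR.*-identityˡ g ⟨
    1# * g          ≈⟨ ℂ-CR.*-congʳ {g} {s * s} {1#} (-1^n*-1^n≈1 (walkLength w)) ⟨
    (s * s) * g     ≈⟨ ℂ-CR.*-assoc s s g ⟩
    s * (s * g)     ≈⟨ ℂ-CR.*-congˡ {s} {weight w} {s * g} (weight≈±walkGain w) ⟨
    s * weight w    ≈⟨ ℂ-CR.*-congˡ {s} {weight w} {1#} (cycle≈1 C) ⟩
    s * 1#          ≈⟨ ℂ-CR.*-identityʳ s ⟩
    s               ∎
    where
    open ≈-Reasoning setoid
    w = DirectedCycle.walk C
    s = (- 1#) ^ walkLength w
    g = walkGain Φ w

  -- From antibalance to a null vector and cospectrality

  module _ (anti : CycleAntibalanced Φ) (connected : StronglyConnected) where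

    private
      cycle≈1 = antibalanced⇒cycle≈1 anti

      toward from : Fin n → Fin n → ℂ
      toward r i = weight (proj₁ (connected i r))
      from   r i = weight (proj₁ (connected r i))

    antibalanced⇒eigenvalue : Fin n → IsEigenvalue (signlessLaplacian Φ) 0#
    antibalanced⇒eigenvalue r = x , x≉0 , λ i → begin
        sum (λ j → signlessLaplacian Φ i j * x j)
          ≈⟨ signlessLaplacian-row Φ x i ⟩
        sum (λ j → entry (arc i j) (λ a → x i + val (φ a) * x j))
          ≈⟨ sum-cong-≋ {n} {λ j → entry (arc i j) (λ a → x i + val (φ a) * x j)} {λ _ → 0#}
               (λ j → entry-elim (_≈ 0#) (arc i j) (λ a → x i + val (φ a) * x j)
                 (ℂ-CR.refl {0#}) cancel) ⟩
        sum {n} (λ _ → 0#)   ≈⟨ sum-replicate-zero n ⟩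
        0#                   ≈⟨ ℂ-CR.zeroˡ (x i) ⟨
        0# * x i             ∎
      where
      open ≈-Reasoning setoid
      x = toward r
      x≉0 : ¬ (∀ i → x i ≈ 0#)
      -- The entry at the root `r` is the weight of a closed walk, hence 1.
      x≉0 x≈0 = ℝ-1≉0 (proj₁ (ℂ-CR.trans {1#} {x r} {0#}
        (ℂ-CR.sym {x r} {1#} (closed⇒weight≈1 cycle≈1 (proj₁ (connected r r)))) (x≈0 r)))
      cancel : ∀ {i j} (a : Arc i j) → x i + val (φ a) * x j ≈ 0#
      cancel {i} {j} a = begin
        x i + g * x j
          -- The weight from `i` to `r` may be computed through `j`, along `a` and then the path
          -- from `j`, which gives `- g * x j`.
          ≈⟨ ℂ-CR.+-congʳ {g * x j} {x i} { - g * x j}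
               (weight-independent cycle≈1 connected
                 (proj₁ (connected i r)) (a ◅ proj₁ (connected j r))) ⟩
        - g * x j + g * x j   ≈⟨ ℂ-CR.distribʳ (x j) (- g) g ⟨
        (- g + g) * x j       ≈⟨ ℂ-CR.*-congʳ {x j} { - g + g} {0#} (ℂ-CR.-‿inverseˡ g) ⟩
        0# * x j              ≈⟨ ℂ-CR.zeroˡ (x j) ⟩
        0#                    ∎
        where g = val (φ a)

    -- Conjugating by diag(toward r), whose inverse is diag(from r), turns
    -- A(D) into −A(Φ).
    antibalanced⇒cospectral : Fin n → Cospectral (signlessLaplacian Φ) (laplacian digraph)
    antibalanced⇒cospectral r = Scaling.cospectral-scale ℂ-commutativeRing
      (λ i → deg⁺ i · 1#) (gainAdjacency Φ) (weightedAdjacency digraph (λ _ → 1#))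
      (toward r) (from r)
      -- A walk from `i` to `j` has the same weight as the detour through `r`: the empty walk gives
      -- the inverse relation, a single arc gives the negated gain.
      (λ i → via (ε {x = i}))
      (λ i j → gain-entry (arc i j) (λ a → val (φ a)) (toward r i * from r j) λ a → ℂ-CR.trans
         {toward r i * from r j} { - val (φ a) * 1#} { - val (φ a)}
         (via (a ◅ ε)) (ℂ-CR.*-identityʳ (- val (φ a))))
      where
      open RawSemiringDefs (RawRing.rawSemiring ℂ-rawRing) using () renaming (_×_ to _·_)
      open ≈-Reasoning setoid
      via : ∀ {i j} (w : DirectedWalk i j) → toward r i * from r j ≈ weight w
      via {i} {j} w = begin
        weight p * weight q   ≈⟨ weight-◅◅ p q ⟨
        weight (p ◅◅ q)       ≈⟨ weight-independent cycle≈1 connected (p ◅◅ q) w ⟩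
        weight w              ∎
        where
        p = proj₁ (connected i r)
        q = proj₁ (connected r j)
      gain-entry : ∀ b (g : T b → ℂ) c → (∀ a → c ≈ - g a) →
        entry b g ≈ c * - entry b (λ _ → 1#)
      gain-entry true g c c≈-g = begin
        g tt             ≈⟨ -‿involutive (g tt) ⟨
        - - g tt         ≈⟨ ℂ-CR.-‿cong {c} { - g tt} (c≈-g tt) ⟨
        - c              ≈⟨ ℂ-CR.-‿cong {c * 1#} {c} (ℂ-CR.*-identityʳ c) ⟨
        - (c * 1#)       ≈⟨ -‿distribʳ-* c 1# ⟩
        c * - 1#         ∎
      gain-entry false g c _ = begin
        0#               ≈⟨ ℂ-CR.zeroʳ c ⟨
        c * 0#           ≈⟨ ℂ-CR.*-congˡ {c} { - 0#} {0#} -0#≈0# ⟨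
        c * - 0#         ∎
        where open RingProperties ℂ-CR.ring using (-0#≈0#)

  -- From a null vector to cycle weights

  module _ (connected : StronglyConnected) (x : Fin n → ℂ)
    (Qx≈0 : ∀ i → sum (λ j → signlessLaplacian Φ i j * x j) ≈ 0# * x i) where

    private
      ∣x∣² : Fin n → ℝ
      ∣x∣² i = ∣ x i ∣²

    module _ {i} (i-max : IsMax ∣x∣² i) where

      private
        z : ∀ {j} → Arc i j → ℂ
        z {j} a = x i + val (φ a) * x j

        -- The summands of 2⟨x_i, (Qx)_i⟩, one for each `j`; they vanish where there is no arc.
        term : Fin n → ℝ
        term j = ⟪ x i + x i , entry (arc i j) z ⟫

        term≈ : ∀ {j} (a : Arc i j) →
          ⟪ x i + x i , z a ⟫ ≈ℝ ∣ z a ∣² ℝ-CR.+ (∣x∣² i ℝ-CR.- ∣x∣² j)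
        term≈ {j} a = ∣x+cy∣² (val (φ a)) (x i) (x j) (modulus (φ a))

        0≤term : ∀ j → NonNeg (term j)
        0≤term j = entry-elim (λ u → NonNeg ⟪ x i + x i , u ⟫) (arc i j) z
          (nonNeg-resp-≈ {ℝ-CR.0#} {⟪ x i + x i , 0# ⟫}
            (ℝ-CR.sym {⟪ x i + x i , 0# ⟫} {ℝ-CR.0#} (⟪,⟫-0ʳ (x i + x i))) nonNeg-0)
          λ a → nonNeg-resp-≈ {∣ z a ∣² ℝ-CR.+ (∣x∣² i ℝ-CR.- ∣x∣² j)} {⟪ x i + x i , z a ⟫}
            (ℝ-CR.sym {⟪ x i + x i , z a ⟫} {∣ z a ∣² ℝ-CR.+ (∣x∣² i ℝ-CR.- ∣x∣² j)} (term≈ a))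
            (nonNeg-+ {∣ z a ∣²} {∣x∣² i ℝ-CR.- ∣x∣² j} (nonNeg-∣∣² (z a)) (i-max j))

        Σterm≈0 : sumℝ term ≈ℝ ℝ-CR.0#
        Σterm≈0 = begin
          sumℝ term
            ≈⟨ ⟪,⟫-sum (x i + x i) (λ j → entry (arc i j) z) ⟨
          ⟪ x i + x i , sum (λ j → entry (arc i j) z) ⟫
            ≈⟨ ⟪,⟫-congʳ (x i + x i) {sum (λ j → entry (arc i j) z)} {0#} row≈0 ⟩
          ⟪ x i + x i , 0# ⟫
            ≈⟨ ⟪,⟫-0ʳ (x i + x i) ⟩
          ℝ-CR.0# ∎
          where
          open ≈-Reasoning ℝ-CR.setoid
          row≈0 : sum (λ j → entry (arc i j) z) ≈ 0#
          row≈0 = ℂ-CR.trans {sum (λ j → entry (arc i j) z)}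
            {sum (λ j → signlessLaplacian Φ i j * x j)} {0#}
            (ℂ-CR.sym {sum (λ j → signlessLaplacian Φ i j * x j)}
              {sum (λ j → entry (arc i j) z)} (signlessLaplacian-row Φ x i))
            (ℂ-CR.trans {sum (λ j → signlessLaplacian Φ i j * x j)} {0# * x i} {0#}
              (Qx≈0 i) (ℂ-CR.zeroˡ (x i)))

        arc-term≈0 : ∀ {j} (a : Arc i j) → ∣ z a ∣² ℝ-CR.+ (∣x∣² i ℝ-CR.- ∣x∣² j) ≈ℝ ℝ-CR.0#
        arc-term≈0 {j} a = begin
          ∣ z a ∣² ℝ-CR.+ (∣x∣² i ℝ-CR.- ∣x∣² j)  ≈⟨ term≈ a ⟨
          ⟪ x i + x i , z a ⟫                      ≡⟨ cong ⟪ x i + x i ,_⟫ (entry-arc (arc i j) z a) ⟨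
          term j                                   ≈⟨ sum-nonNeg≈0 term 0≤term Σterm≈0 j ⟩
          ℝ-CR.0#                                  ∎
          where open ≈-Reasoning ℝ-CR.setoid

      -- A sum of nonnegative terms that is zero has zero terms, and each term is itself |z|² plus
      -- the nonnegative gap |x_i|² - |x_j|²; the first part gives the claim.
      max⇒cancel : ∀ {j} (a : Arc i j) → z a ≈ 0#
      max⇒cancel {j} a = ∣z∣²≈0⇒z≈0 (z a)
        (nonNeg-+-≈0 {∣ z a ∣²} {∣x∣² i ℝ-CR.- ∣x∣² j} (nonNeg-∣∣² (z a)) (i-max j) (arc-term≈0 a))

      -- The gap |x_i|² - |x_j|² is the other part of the same vanishing term.
      max-step : ∀ {j} → Arc i j → IsMax ∣x∣² j
      max-step {j} a k = nonNeg-trans (∣x∣² j) (∣x∣² i) (∣x∣² k) j≥i (i-max k)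
        where
        gap = ∣x∣² i ℝ-CR.- ∣x∣² j
        gap≈0 : gap ≈ℝ ℝ-CR.0#
        gap≈0 = nonNeg-+-≈0 {gap} {∣ z a ∣²} (i-max j) (nonNeg-∣∣² (z a))
          (ℝ-CR.trans {gap ℝ-CR.+ ∣ z a ∣²} {∣ z a ∣² ℝ-CR.+ gap} {ℝ-CR.0#}
            (ℝ-CR.+-comm gap ∣ z a ∣²) (arc-term≈0 a))
        j≥i : NonNeg (∣x∣² j ℝ-CR.- ∣x∣² i)
        j≥i = nonNeg-resp-≈ {∣x∣² j ℝ-CR.- ∣x∣² j} {∣x∣² j ℝ-CR.- ∣x∣² i}
          (ℝ-CR.+-congˡ {∣x∣² j} {ℝ-CR.- ∣x∣² j} {ℝ-CR.- ∣x∣² i}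
            (ℝ-CR.-‿cong {∣x∣² j} {∣x∣² i}
              (ℝ-CR.sym {∣x∣² i} {∣x∣² j} (x∙y⁻¹≈ε⇒x≈y (∣x∣² i) (∣x∣² j) gap≈0))))
          (nonNeg-x-x (∣x∣² j))
          where open GroupProperties ℝ-CR.+-group using (x∙y⁻¹≈ε⇒x≈y)

    max-walk : ∀ {i j} → DirectedWalk i j → IsMax ∣x∣² i → IsMax ∣x∣² j
    max-walk ε       i-max = i-max
    max-walk (a ◅ w) i-max = max-walk w (max-step i-max a)

    -- Along each arc the relation x_i = -φ x_k holds because maximality has been carried to its
    -- source; the factors -φ multiply to the weight.
    weight*x : ∀ {i j} (w : DirectedWalk i j) → IsMax ∣x∣² i → weight w * x j ≈ x i
    weight*x {i}     ε             i-max = ℂ-CR.*-identityˡ (x i)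
    weight*x {i} {j} (_◅_ {j = k} a w) i-max = begin
      (- g * weight w) * x j   ≈⟨ ℂ-CR.*-assoc (- g) (weight w) (x j) ⟩
      - g * (weight w * x j)
        ≈⟨ ℂ-CR.*-congˡ { - g} {weight w * x j} {x k} (weight*x w (max-step i-max a)) ⟩
      - g * x k                ≈⟨ -‿distribˡ-* g (x k) ⟨
      - (g * x k)              ≈⟨ inverseˡ-unique (x i) (g * x k) (max⇒cancel i-max a) ⟨
      x i                      ∎
      where
      open ≈-Reasoning setoid
      open RingProperties ℂ-CR.ring using (-‿distribˡ-*)
      open GroupProperties ℂ-CR.+-group using (inverseˡ-unique)
      g = val (φ a)

    -- If the maximum were 0, then |x_j|² and its gap to the maximum would be nonnegative with sum
    -- 0, so every x_j would vanish.
    max≉0 : ∀ {i} → IsMax ∣x∣² i → ¬ (∀ j → x j ≈ 0#) → ¬ (∣x∣² i ≈ℝ ℝ-CR.0#)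
    max≉0 {i} i-max x≉0 ∣xi∣²≈0 = x≉0 λ j → ∣z∣²≈0⇒z≈0 (x j)
      (nonNeg-+-≈0 {∣x∣² j} {∣x∣² i ℝ-CR.- ∣x∣² j} (nonNeg-∣∣² (x j)) (i-max j)
        (ℝ-CR.trans {∣x∣² j ℝ-CR.+ (∣x∣² i ℝ-CR.- ∣x∣² j)} {∣x∣² i} {ℝ-CR.0#}
          (≗⇒≈ (∣x∣² j ℝ-CR.+ (∣x∣² i ℝ-CR.- ∣x∣² j)) (∣x∣² i) λ m →
            solve 2 (λ a b → a :+ (b :- a) := b) refl (seq (∣x∣² j) m) (seq (∣x∣² i) m))
          ∣xi∣²≈0))
      where open +-*-Solver

    -- Strong connectivity carries maximality from `m` to the base `i`; there `weight w * x i ≈ x i`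
    -- with `x i` nonzero.
    max⇒closed≈1 : ∀ {m i} → IsMax ∣x∣² m → ¬ (∀ j → x j ≈ 0#) →
      (w : DirectedWalk i i) → weight w ≈ 1#
    max⇒closed≈1 {m} {i} m-max x≉0 w =
      ℂ-cancel (weight w) (x i) (weight*x w i-max) (max≉0 i-max x≉0)
      where i-max = max-walk (proj₁ (connected m i)) m-max

eigenvalue⇒antibalanced : ∀ {n} (Φ : GainDigraph (suc n)) → GainDigraph.StronglyConnected Φ →
  IsEigenvalue (signlessLaplacian Φ) ℂ-ring.0# → CycleAntibalanced Φ
eigenvalue⇒antibalanced Φ connected (x , x≉0 , Qx≈0) = cycle≈1⇒antibalanced λ C →
  -- The goal is a stable equation, so a maximal vertex known only up to double negation may be
  -- used.
  ℂ-stable (weight (DirectedCycle.walk C)) ℂ-CR.1# λ w≉1 →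
    ¬¬-max (λ i → ∣ x i ∣²) λ (m , m-max) →
      w≉1 (max⇒closed≈1 connected x Qx≈0 m-max x≉0 (DirectedCycle.walk C))
  where
  open Antigain Φ
  open GainDigraph Φ using (module DirectedCycle)

corollary5p5 : ∀ (n : ℕ) .{{_ : NonZero n}} (Φ : GainDigraph n) →
    GainDigraph.StronglyConnected Φ →
    (IsEigenvalue (signlessLaplacian Φ) ℂ-ring.0# ⇔ CycleAntibalanced Φ)
    × (CycleAntibalanced Φ →
    Cospectral (signlessLaplacian Φ) (laplacian (GainDigraph.digraph Φ)))
corollary5p5 zero    Φ connected = contradiction refl (ℕ.≢-nonZero⁻¹ 0)
corollary5p5 (suc n) Φ connected =
    mk⇔ (eigenvalue⇒antibalanced Φ connected)
        -- The vertex `zero` is chosen as the root `r`; positivity of the order guarantees that it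
        -- exists.
        (λ anti → antibalanced⇒eigenvalue anti connected zero)
  , λ anti → antibalanced⇒cospectral anti connected zero
  where open Antigain Φ
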